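{- For every graph $G$ with all connected components of even order we have that $\chi_{\mathsf{odd}}(G) \leq \mathsf{tw}(G)+1$, and this bound is tight.
   Context: All graphs are finite, simple and undirected. The order of a graph is its number of vertices. A graph is called odd if every vertex has odd degree. $\chi_{\mathsf{odd}}(G)$, the odd chromatic number of $G$, is the minimum number of odd induced subgraphs of $G$ whose vertex sets partition $V(G)$. (By a theorem of Scott, such a partition exists if and only if every connected component of $G$ has even order.) $\mathsf{tw}(G)$ denotes the tree-width of $G$. -}

module Defs where

open import Data.Fin.Base using (Fin)
open import Data.Fin.Subset using (Subset; _∈_; _∉_; _∩_; ∣_∣; Nonempty)
open import Data.Integer.Base as ℤ using (ℤ; +_)
open import Data.List.Base using (_∷_; _∷ʳ_; length; map; allFin)
open import Data.List.Extrema.Nat using (max)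
open import Data.List.Relation.Unary.Linked using (Linked)
open import Data.List.Relation.Unary.Unique.Propositional using (Unique)
open import Data.Nat.Base using (ℕ; _≤_)
open import Data.Nat.Divisibility using (_∣_)
open import Data.Product using (∃; ∃₂; ∃!; _×_)
open import Function.Bundles using (_⇔_)
open import Relation.Binary.Construct.Closure.ReflexiveTransitive using (Star)
open import Relation.Binary.PropositionalEquality using (_≡_)
open import Relation.Nullary using (¬_)

Even Odd : ℕ → Set
Even k = 2 ∣ k
Odd k  = ¬ Even k

-- Finite simple undirected graphs with vertex set Fin n, given by their
-- open neighbourhoods.
record Graph (n : ℕ) : Set where
  field
    N         : Fin n → Subset n
    symmetric : ∀ {u v} → v ∈ N u → u ∈ N v
    loopless  : ∀ v → v ∉ N v

  Adj : Fin n → Fin n → Set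
  Adj u v = v ∈ N u

  -- For v ∈ S, the degree of v in the subgraph induced by S.
  degreeIn : Subset n → Fin n → ℕ
  degreeIn S v = ∣ N v ∩ S ∣

open Graph public

IsComponent : ∀ {n} → Graph n → Subset n → Set
IsComponent G C = ∃ λ v → ∀ u → u ∈ C ⇔ Star (Adj G) v u

AllComponentsEven : ∀ {n} → Graph n → Set
AllComponentsEven G = ∀ C → IsComponent G C → Even ∣ C ∣

InducesOdd : ∀ {n} → Graph n → Subset n → Set
InducesOdd G S = ∀ v → v ∈ S → Odd (degreeIn G S v)

record OddPartition {n} (G : Graph n) (c : ℕ) : Set where
  field
    part      : Fin c → Subset n
    nonempty  : ∀ i → Nonempty (part i)
    partition : ∀ v → ∃! _≡_ (λ i → v ∈ part i)
    odd       : ∀ i → InducesOdd G (part i)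

IsOddChromaticNumber : ∀ {n} → Graph n → ℕ → Set
IsOddChromaticNumber G c = OddPartition G c × (∀ d → OddPartition G d → c ≤ d)

-- A cycle is listed without repetition as x ∷ xs, with at least three vertices.
HasCycle : ∀ {n} → Graph n → Set
HasCycle G = ∃₂ λ x xs →
  2 ≤ length xs × Unique (x ∷ xs) × Linked (Adj G) (x ∷ (xs ∷ʳ x))

record IsTree {m} (T : Graph m) : Set where
  field
    root      : Fin m   -- trees are nonempty
    connected : ∀ s t → Star (Adj T) s t
    acyclic   : ¬ HasCycle T

record TreeDecomposition {n} (G : Graph n) : Set where
  field
    size   : ℕ
    tree   : Graph size
    isTree : IsTree tree
    bag    : Fin size → Subset n

    coversVertices : ∀ v → ∃ λ t → v ∈ bag t
    coversEdges    : ∀ u v → Adj G u v → ∃ λ t → u ∈ bag t × v ∈ bag t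

    -- The nodes whose bags contain v induce a connected subgraph of the tree.
    nodesConnected : ∀ v s t → v ∈ bag s → v ∈ bag t →
                     Star (λ a b → v ∈ bag a × v ∈ bag b × Adj tree a b) s t

  -- An integer, so that the graph without vertices has tree-width -1.
  width : ℤ
  width = + max 0 (map (λ t → ∣ bag t ∣) (allFin size)) ℤ.- + 1

open TreeDecomposition public using (width)

IsTreeWidth : ∀ {n} → Graph n → ℤ → Set
IsTreeWidth G w =
  (∃ λ (D : TreeDecomposition G) → width D ≡ w) ×
  (∀ (D : TreeDecomposition G) → w ℤ.≤ width D)

{-# OPTIONS --safe #-}
module Submission where

-- Upper bound: a spanning subgraph E with all degrees odd and as few edges as possible has
-- induced components, because an edge of G outside E joining two vertices of one component
-- could replace a path of at least two edges. The components of E are connected in G, so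
-- contracting them does not increase the tree-width, and the contracted graph has a proper
-- colouring with tw + 1 colours. Components of the same colour are pairwise non-adjacent,
-- hence every colour class induces an odd graph.
--
-- Tightness: if any two of k + 1 branch vertices have a common neighbour of degree two, then
-- the branch vertices lie in distinct parts. If all edges join a branch vertex to one of
-- degree at most two, a star-shaped decomposition has width k for k ≥ 2, and width k is
-- optimal by the upper bound. For k = 1, take the path on four vertices.

open import Defs
open import Algebra.Bundles using (CommutativeRing)
open import Data.Bool.Base using (Bool; true; false; not; _∧_; _∨_; _xor_)
open import Data.Bool.Properties using (xor-∧-commutativeRing; xor-same; xor-comm; xor-identityʳ; ∧-zeroʳ; ∧-identityʳ; ∧-comm; ∨-zeroʳ; ¬-not) renaming (_≟_ to _≟ᵇ_)
open import Data.Fin.Base using (Fin; zero; suc; toℕ; fromℕ<; punchOut; combine; remQuot)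
open import Data.Fin.Patterns using (0F; 1F; 2F; 3F)
open import Data.Fin.Properties using (_≟_; any?; all?; <-cmp; suc-injective; toℕ<n; toℕ-fromℕ<; punchOut-injective; punchOut-cong; injective⇒≤; remQuot-combine; combine-remQuot; combine-injectiveˡ) renaming (_<?_ to _<ᶠ?_)
open import Data.Fin.Subset using (Subset; _∈_; _∉_; _⊆_; _⊃_; _∪_; _∩_; _-_; ⁅_⁆; ⊥; ⊤; ∣_∣)
open import Data.Fin.Subset.Induction using (⊃-wellFounded)
open import Data.Fin.Subset.Properties using (_∈?_; ∉⊥; ∈⊤; ∣⊥∣≡0; ∣⊤∣≡n; ∣p∣≤n; p⊆p∪q; q⊆p∪q; p⊆q⇒∣p∣≤∣q∣; p⊂q⇒∣p∣<∣q∣; x∈p∪q⁺; x∈p∪q⁻; x∈⁅x⁆; x∈⁅y⁆⇒x≡y; x∈p∧x≢y⇒x∈p-y; x∈p⇒∣p-x∣<∣p∣; ∣⁅x⁆∣≡1)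
open import Data.Integer.Base as ℤ using (+_; +≤+)
open import Data.List.Base using (List; []; _∷_; _∷ʳ_; map; allFin)
open import Data.List.Extrema.Nat using (max; xs≤max; max≤v⁺)
open import Data.List.Membership.Propositional using () renaming (_∈_ to _∈ₗ_)
open import Data.List.Membership.Propositional.Properties using (∈-allFin; ∈-map⁺)
open import Data.List.Relation.Unary.All using ([]; _∷_) renaming (lookup to lookupAll; universal to universalAll)
open import Data.List.Relation.Unary.All.Properties using (¬Any⇒All¬) renaming (map⁺ to All-map⁺)
open import Data.List.Relation.Unary.AllPairs using ([]; _∷_)
open import Data.List.Relation.Unary.Any using (here; there) renaming (any? to anyₗ?)
open import Data.List.Relation.Unary.Linked using (Linked; [-]; _∷_)
open import Data.List.Relation.Unary.Unique.Propositional using (Unique)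
open import Data.Nat.Base using (ℕ; zero; suc; _+_; _*_; _≤_; _<_; z≤n; s≤s)
open import Data.Nat.Divisibility using (_∣?_; divides; _∣0; ∣-refl; ∣m+n∣m⇒∣n; ∣m∣n⇒∣m+n; ∣m⇒∣m*n; ∣n⇒∣m*n; ∣1⇒≡1)
open import Data.Nat.Induction using (<-wellFounded)
open import Data.Nat.Properties using (≤-refl; ≤-trans; ≤-reflexive; ≤-antisym; ≤-<-trans; <-≤-trans; <-irrefl; ≮⇒≥; +-mono-≤; +-mono-<-≤; +-mono-≤-<; +-monoʳ-≤; +-comm; +-suc; m≤n⇒m≤1+n; +-0-commutativeMonoid; module ≤-Reasoning) renaming (_<?_ to _<ⁿ?_)
open import Data.Product using (Σ; ∃; ∃₂; _×_; _,_; proj₁; proj₂)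
open import Data.Sum.Base using (_⊎_; inj₁; inj₂; [_,_]′)
open import Data.Unit.Base using (tt)
open import Data.Vec.Base using (Vec; []; _∷_; here; there; lookup; tabulate)
open import Data.Vec.Properties using (lookup∘tabulate; lookup-zipWith; []=⇒lookup; lookup⇒[]=)
open import Function.Base using (_∘_)
open import Function.Bundles using (Equivalence; mk⇔)
open import Induction.WellFounded using (Acc; acc)
open import Level using (0ℓ)
open import Relation.Binary.Construct.Closure.ReflexiveTransitive using (Star; ε; _◅_; _◅◅_; reverse) renaming (map to mapStar)
open import Relation.Binary.Core using (Rel)
open import Relation.Binary.Definitions using (Decidable; tri<; tri≈; tri>)
open import Relation.Binary.PropositionalEquality using (_≡_; _≢_; refl; sym; trans; cong; cong₂; subst; module ≡-Reasoning)
open import Relation.Nullary using (¬_; Dec; yes; no; does; contradiction; ¬?; _×-dec_; _⊎-dec_; _→-dec_)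
open import Relation.Nullary.Decidable using (map′; dec-true; dec-false; does-⇔; decidable-stable; toWitness)
open import Algebra.Properties.CommutativeMonoid.Sum +-0-commutativeMonoid using (sum)
open import Algebra.Properties.CommutativeMonoid.Sum (CommutativeRing.+-commutativeMonoid xor-∧-commutativeRing) using (∑-distrib-+; ∑-comm; sum-cong-≗; sum-replicate-zero) renaming (sum to ⨁)

private variable
  n : ℕ

-- Parity

odd-suc : ∀ {k} → Even k → Odd (suc k)
odd-suc {k} 2∣k 2∣1+k with ∣1⇒≡1 (∣m+n∣m⇒∣n (subst Even (+-comm 1 k) 2∣1+k) 2∣k)
... | ()

even-suc : ∀ k → Odd k → Even (suc k)
even-suc zero          odd = contradiction (2 ∣0) odd
even-suc (suc zero)    odd = ∣-refl
even-suc (suc (suc k)) odd = ∣m∣n⇒∣m+n ∣-refl (even-suc k (odd ∘ ∣m∣n⇒∣m+n ∣-refl))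

-- Parities become sums `⨁` over the field with two elements, so that degree counts can be handled
-- by linearity and exchange of summation.
⨁≡false⇒even : ∀ (p : Subset n) → ⨁ (lookup p) ≡ false → Even ∣ p ∣
⨁≡true⇒odd   : ∀ (p : Subset n) → ⨁ (lookup p) ≡ true  → Odd ∣ p ∣
⨁≡false⇒even []          eq = 2 ∣0
⨁≡false⇒even (false ∷ p) eq = ⨁≡false⇒even p eq
⨁≡false⇒even (true ∷ p)  eq with ⨁ (lookup p) in e
⨁≡false⇒even (true ∷ p)  eq | true = even-suc ∣ p ∣ (⨁≡true⇒odd p e)
⨁≡true⇒odd (false ∷ p) eq = ⨁≡true⇒odd p eq
⨁≡true⇒odd (true ∷ p)  eq with ⨁ (lookup p) in e
⨁≡true⇒odd (true ∷ p)  eq | false = odd-suc (⨁≡false⇒even p e)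

even⇒⨁≡false : ∀ (p : Subset n) → Even ∣ p ∣ → ⨁ (lookup p) ≡ false
even⇒⨁≡false p even = ¬-not (λ eq → ⨁≡true⇒odd p eq even)

odd⇒⨁≡true : ∀ (p : Subset n) → Odd ∣ p ∣ → ⨁ (lookup p) ≡ true
odd⇒⨁≡true p odd = ¬-not (odd ∘ ⨁≡false⇒even p)

δ : Fin n → Fin n → Bool
δ i j = does (i ≟ j)

δ-refl : ∀ (i : Fin n) → δ i i ≡ true
δ-refl i = dec-true (i ≟ i) refl

does-true : ∀ {A : Set} (a? : Dec A) → does a? ≡ true → A
does-true (yes a) _ = a

⨁-∧δ : ∀ c (a : Fin n) → ⨁ (λ y → c ∧ δ y a) ≡ c
⨁-∧δ {n = suc n} true zero = cong not (sum-replicate-zero n)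
⨁-∧δ true (suc a) = ⨁-∧δ true a
⨁-∧δ {n} false a  = sum-replicate-zero n

⨁-δ∧ : ∀ (a : Fin n) (f : Fin n → Bool) → ⨁ (λ y → δ a y ∧ f y) ≡ f a
⨁-δ∧ {suc n} zero f = trans (cong (f zero xor_) (sum-replicate-zero n)) (xor-identityʳ _)
⨁-δ∧ (suc a) f = ⨁-δ∧ a (f ∘ suc)

⨁≡true⇒∃ : ∀ {f : Fin n → Bool} → ⨁ f ≡ true → ∃ λ i → f i ≡ true
⨁≡true⇒∃ {suc n} {f} eq with f zero in e
... | true  = zero , e
... | false with ⨁≡true⇒∃ eq
...   | i , fi = suc i , fi

∈-tabulate⁺ : ∀ {f : Fin n → Bool} {i} → f i ≡ true → i ∈ tabulate f
∈-tabulate⁺ {f = f} {i} eq = lookup⇒[]= i (tabulate f) (trans (lookup∘tabulate f i) eq)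

∈-tabulate⁻ : ∀ {f : Fin n → Bool} {i} → i ∈ tabulate f → f i ≡ true
∈-tabulate⁻ {f = f} {i} i∈ = trans (sym (lookup∘tabulate f i)) ([]=⇒lookup i∈)

-- Reachability in a finite relation

-- As in the Floyd–Warshall algorithm, the list holds the permitted intermediate vertices.
Via : Rel (Fin n) 0ℓ → List (Fin n) → Rel (Fin n) 0ℓ
Via R []       x y = x ≡ y ⊎ R x y
Via R (k ∷ ks) x y = Via R ks x y ⊎ (Via R ks x k × Via R ks k y)

module _ {R : Rel (Fin n) 0ℓ} where

  via⇒star : ∀ ks {x y} → Via R ks x y → Star R x y
  via⇒star []       (inj₁ refl)    = ε
  via⇒star []       (inj₂ r)       = r ◅ ε
  via⇒star (k ∷ ks) (inj₁ p)       = via⇒star ks p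
  via⇒star (k ∷ ks) (inj₂ (p , q)) = via⇒star ks p ◅◅ via⇒star ks q

  via-base : ∀ ks {x y} → Via R [] x y → Via R ks x y
  via-base []       p = p
  via-base (k ∷ ks) p = inj₁ (via-base ks p)

  via-trans : ∀ ks {x k y} → k ∈ₗ ks → Via R ks x k → Via R ks k y → Via R ks x y
  via-trans (k ∷ ks) {x} {_} {y} (here refl) p q = inj₂ (into p , from q)
    where
    into : Via R (k ∷ ks) x k → Via R ks x k
    into (inj₁ p)       = p
    into (inj₂ (p , _)) = p
    from : Via R (k ∷ ks) k y → Via R ks k y
    from (inj₁ q)       = q
    from (inj₂ (_ , q)) = q
  via-trans (_ ∷ ks) (there k∈) (inj₁ p)        (inj₁ q)        = inj₁ (via-trans ks k∈ p q)
  via-trans (_ ∷ ks) (there k∈) (inj₁ p)        (inj₂ (q , q′)) = inj₂ (via-trans ks k∈ p q , q′)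
  via-trans (_ ∷ ks) (there k∈) (inj₂ (p , p′)) (inj₁ q)        = inj₂ (p , via-trans ks k∈ p′ q)
  -- Both walks pass through the head of the list, so everything between these two visits, `k`
  -- included, is cut out.
  via-trans (_ ∷ ks) (there k∈) (inj₂ (p , _))  (inj₂ (_ , q))  = inj₂ (p , q)

  star⇒via : ∀ {x y} → Star R x y → Via R (allFin n) x y
  star⇒via ε       = via-base (allFin n) (inj₁ refl)
  star⇒via (_◅_ {j = j} r w) =
    via-trans (allFin n) (∈-allFin j) (via-base (allFin n) (inj₂ r)) (star⇒via w)

  via? : Decidable R → ∀ ks → Decidable (Via R ks)
  via? R? []       x y = (x ≟ y) ⊎-dec R? x y
  via? R? (k ∷ ks) x y = via? R? ks x y ⊎-dec (via? R? ks x k ×-dec via? R? ks k y)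

  star? : Decidable R → Decidable (Star R)
  star? R? x y = map′ (via⇒star (allFin n)) star⇒via (via? R? (allFin n) x y)

-- Sets of edges

EdgeSet : ℕ → Set
EdgeSet n = Fin n → Fin n → Bool

-- With `xor` in place of `∨`, the row sums in `⨁-edge` need no case `a ≡ b`: `edge a a` is empty.
edge : Fin n → Fin n → EdgeSet n
edge a b x y = (δ x a ∧ δ y b) xor (δ x b ∧ δ y a)

edge-sym : ∀ (a b x y : Fin n) → edge a b x y ≡ edge a b y x
edge-sym a b x y = trans (xor-comm (δ x a ∧ δ y b) (δ x b ∧ δ y a))
  (cong₂ _xor_ (∧-comm (δ x b) (δ y a)) (∧-comm (δ x a) (δ y b)))

edge⇒ends : ∀ {a b x y : Fin n} → edge a b x y ≡ true → (x ≡ a × y ≡ b) ⊎ (x ≡ b × y ≡ a)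
edge⇒ends {a = a} {b} {x} {y} eq with x ≟ a | y ≟ b | x ≟ b | y ≟ a
... | yes p | yes q | _     | _     = inj₁ (p , q)
... | yes _ | no _  | yes p | yes q = inj₂ (p , q)
... | no _  | _     | yes p | yes q = inj₂ (p , q)

⨁-edge : ∀ (a b x : Fin n) → ⨁ (edge a b x) ≡ δ x a xor δ x b
⨁-edge a b x = trans (∑-distrib-+ (λ y → δ x a ∧ δ y b) (λ y → δ x b ∧ δ y a))
  (cong₂ _xor_ (⨁-∧δ (δ x a) b) (⨁-∧δ (δ x b) a))

-- Repeated edges of the walk cancel.
edgesOf : ∀ {R : Rel (Fin n) 0ℓ} {u v} → Star R u v → EdgeSet n
edgesOf ε                         x y = false
edgesOf (_◅_ {i = i} {j = j} r w) x y = edge i j x y xor edgesOf w x y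

edgesOf-sym : ∀ {R : Rel (Fin n) 0ℓ} {u v} (w : Star R u v) x y → edgesOf w x y ≡ edgesOf w y x
edgesOf-sym ε       x y = refl
edgesOf-sym (_◅_ {i = i} {j = j} r w) x y = cong₂ _xor_ (edge-sym i j x y) (edgesOf-sym w x y)

xor-true : ∀ {a b} → a xor b ≡ true → (a ≡ true × b ≡ false) ⊎ (a ≡ false × b ≡ true)
xor-true {true}  {false} _ = inj₁ (refl , refl)
xor-true {false} {true}  _ = inj₂ (refl , refl)

edgesOf⇒R : ∀ {R : Rel (Fin n) 0ℓ} → (∀ {x y} → R x y → R y x) →
            ∀ {u v} (w : Star R u v) {x y} → edgesOf w x y ≡ true → R x y
edgesOf⇒R sy (_◅_ {i = i} {j = j} r w) {x} {y} eq with xor-true {edge i j x y} eq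
... | inj₂ (_ , e) = edgesOf⇒R sy w e
... | inj₁ (e , _) with edge⇒ends {a = i} {j} {x} {y} e
...   | inj₁ (refl , refl) = r
...   | inj₂ (refl , refl) = sy r

xor-telescope : ∀ a b c → (a xor b) xor (b xor c) ≡ a xor c
xor-telescope false false c = refl
xor-telescope false true  false = refl
xor-telescope false true  true = refl
xor-telescope true  false c = refl
xor-telescope true  true  c = refl

-- Degrees modulo 2 telescope along the walk and only the two ends remain: `edgesOf w` is a T-join
-- for the ends of `w`.
⨁-edgesOf : ∀ {R : Rel (Fin n) 0ℓ} {u v} (w : Star R u v) x → ⨁ (edgesOf w x) ≡ δ x u xor δ x v
⨁-edgesOf {n = n} {u = u} ε x = trans (sum-replicate-zero n) (sym (xor-same (δ x u)))
⨁-edgesOf {v = v} (_◅_ {i = i} {j = j} r w) x =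
  trans (∑-distrib-+ (edge i j x) (edgesOf w x))
    (trans (cong₂ _xor_ (⨁-edge i j x) (⨁-edgesOf w x)) (xor-telescope (δ x i) (δ x j) (δ x v)))

-- Spanning subgraphs with all degrees odd

record OddSpanning (G : Graph n) : Set where
  field
    E      : EdgeSet n
    E-sym  : ∀ x y → E x y ≡ E y x
    E⇒adj  : ∀ {x y} → E x y ≡ true → Adj G x y
    E-odd  : ∀ x → ⨁ (E x) ≡ true

  _∼_ : Rel (Fin n) 0ℓ
  _∼_ = Star (λ x y → E x y ≡ true)

  _∼?_ : Decidable _∼_
  _∼?_ = star? (λ x y → E x y ≟ᵇ true)

  ∼-sym : ∀ {x y} → x ∼ y → y ∼ x
  ∼-sym = reverse (λ {x} {y} e → trans (E-sym y x) e)

open OddSpanning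

adj? : ∀ (G : Graph n) → Decidable (Adj G)
adj? G u v = v ∈? N G u

connected? : ∀ (G : Graph n) → Decidable (Star (Adj G))
connected? G = star? (adj? G)

-- The sum, over all pairs of connected vertices u < v, of a walk from u to v: it meets
-- x with the parity of the number of vertices other than x in the component of x.
module _ (G : Graph n) (even : AllComponentsEven G) where

  private
    ~ : Fin n → Fin n → Bool
    ~ u v = does (connected? G u v)

    pair? : ∀ u v → Dec (toℕ u < toℕ v × Star (Adj G) u v)
    pair? u v = (u <ᶠ? v) ×-dec connected? G u v

    pair : Fin n → Fin n → Bool
    pair u v = does (pair? u v)

    -- The decision is an argument so that the lemmas below can split on it directly.
    walkIf : ∀ {u v} → Dec (toℕ u < toℕ v × Star (Adj G) u v) → EdgeSet n
    walkIf (yes (_ , w)) = edgesOf w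
    walkIf (no _)        = λ _ _ → false

    walk : Fin n → Fin n → EdgeSet n
    walk u v = walkIf (pair? u v)

    walkIf-sym : ∀ {u v} (d : Dec (toℕ u < toℕ v × Star (Adj G) u v)) x y →
                 walkIf d x y ≡ walkIf d y x
    walkIf-sym (yes (_ , w)) x y = edgesOf-sym w x y
    walkIf-sym (no _)        x y = refl

    walkIf⇒adj : ∀ {u v} (d : Dec (toℕ u < toℕ v × Star (Adj G) u v)) {x y} →
                 walkIf d x y ≡ true → Adj G x y
    walkIf⇒adj (yes (_ , w)) eq = edgesOf⇒R (symmetric G) w eq

    ⨁-walkIf : ∀ {u v} (d : Dec (toℕ u < toℕ v × Star (Adj G) u v)) x →
               ⨁ (walkIf d x) ≡ (δ x u ∧ does d) xor (δ x v ∧ does d)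
    ⨁-walkIf {u} {v} (yes (_ , w)) x = trans (⨁-edgesOf w x)
      (sym (cong₂ _xor_ (∧-identityʳ (δ x u)) (∧-identityʳ (δ x v))))
    ⨁-walkIf {u} {v} (no _) x = trans (sum-replicate-zero n)
      (sym (cong₂ _xor_ (∧-zeroʳ (δ x u)) (∧-zeroʳ (δ x v))))

    F : EdgeSet n
    F x y = ⨁ λ u → ⨁ λ v → walk u v x y

    ~-sym : ∀ x y → ~ x y ≡ ~ y x
    ~-sym x y = does-⇔ (mk⇔ (reverse (symmetric G)) (reverse (symmetric G))) (connected? G x y) (connected? G y x)

    -- For `v ≢ x` exactly one of `(x , v)` and `(v , x)` is increasing; the term `δ v x` removes
    -- `x` from its own component.
    pairs-at : ∀ x v → pair x v xor pair v x ≡ δ v x xor ~ x v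
    pairs-at x v with <-cmp x v
    ... | tri< x<v x≢v v≮x
      rewrite dec-true (x <ᶠ? v) x<v | dec-false (v <ᶠ? x) v≮x | dec-false (v ≟ x) (x≢v ∘ sym) = xor-identityʳ _
    ... | tri> x≮v x≢v v<x
      rewrite dec-false (x <ᶠ? v) x≮v | dec-true (v <ᶠ? x) v<x | dec-false (v ≟ x) (x≢v ∘ sym) = ~-sym v x
    ... | tri≈ x≮v refl _ rewrite dec-false (x <ᶠ? v) x≮v | δ-refl x | dec-true (connected? G x x) ε = refl

    component : Fin n → Subset n
    component x = tabulate (~ x)

    component-isComponent : ∀ x → IsComponent G (component x)
    component-isComponent x = x , λ u → mk⇔ (to u) (from u)
      where
      to : ∀ u → u ∈ component x → Star (Adj G) x u
      to u u∈ = does-true (connected? G x u) (∈-tabulate⁻ u∈)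
      from : ∀ u → Star (Adj G) x u → u ∈ component x
      from u w = ∈-tabulate⁺ (dec-true (connected? G x u) w)

    ⨁-component : ∀ x → ⨁ (~ x) ≡ false
    ⨁-component x = trans (sum-cong-≗ (sym ∘ lookup∘tabulate (~ x)))
      (even⇒⨁≡false (component x) (even (component x) (component-isComponent x)))

    ⨁-xor : ∀ (f g : Fin n → Bool) → ⨁ (λ i → f i xor g i) ≡ ⨁ f xor ⨁ g
    ⨁-xor = ∑-distrib-+

    F-odd : ∀ x → ⨁ (F x) ≡ true
    F-odd x = begin
      (⨁ λ y → ⨁ λ u → ⨁ λ v → walk u v x y)
        ≡⟨ ∑-comm (λ y u → ⨁ λ v → walk u v x y) ⟩
      (⨁ λ u → ⨁ λ y → ⨁ λ v → walk u v x y)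
        ≡⟨ sum-cong-≗ (λ u → ∑-comm (λ y v → walk u v x y)) ⟩
      (⨁ λ u → ⨁ λ v → ⨁ (walk u v x))
        -- A walk has odd degree only at its ends, so modulo 2 only the walks that start or end at
        -- `x` count.
        ≡⟨ sum-cong-≗ (λ u → sum-cong-≗ (λ v → ⨁-walkIf (pair? u v) x)) ⟩
      (⨁ λ u → ⨁ λ v → (δ x u ∧ pair u v) xor (δ x v ∧ pair u v))
        ≡⟨ sum-cong-≗ (λ u → ⨁-xor (λ v → δ x u ∧ pair u v) (λ v → δ x v ∧ pair u v)) ⟩
      (⨁ λ u → (⨁ λ v → δ x u ∧ pair u v) xor (⨁ λ v → δ x v ∧ pair u v))
        ≡⟨ ⨁-xor (λ u → ⨁ λ v → δ x u ∧ pair u v) (λ u → ⨁ λ v → δ x v ∧ pair u v) ⟩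
      (⨁ λ u → ⨁ λ v → δ x u ∧ pair u v) xor (⨁ λ u → ⨁ λ v → δ x v ∧ pair u v)
        ≡⟨ cong₂ _xor_ (trans (∑-comm (λ u v → δ x u ∧ pair u v))
                              (sum-cong-≗ (λ v → ⨁-δ∧ x (λ u → pair u v))))
                       (sum-cong-≗ (λ u → ⨁-δ∧ x (pair u))) ⟩
      (⨁ (pair x)) xor (⨁ λ v → pair v x)
        ≡⟨ ⨁-xor (pair x) (λ v → pair v x) ⟨
      (⨁ λ v → pair x v xor pair v x)
        ≡⟨ sum-cong-≗ (pairs-at x) ⟩
      (⨁ λ v → δ v x xor ~ x v)
        ≡⟨ ⨁-xor (λ v → δ v x) (~ x) ⟩
      (⨁ λ v → δ v x) xor ⨁ (~ x)
        -- The component of `x` has even order; leaving out `x` makes the count odd.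
        ≡⟨ cong₂ _xor_ (⨁-∧δ true x) (⨁-component x) ⟩
      true ∎
      where open ≡-Reasoning

    F⇒adj : ∀ {x y} → F x y ≡ true → Adj G x y
    F⇒adj eq with ⨁≡true⇒∃ eq
    ... | u , eq′ with ⨁≡true⇒∃ eq′
    ...   | v , eq″ = walkIf⇒adj (pair? u v) eq″

  abstract
    oddSpanning : OddSpanning G
    oddSpanning = record
      { E     = F
      ; E-sym = λ x y → sum-cong-≗ (λ u → sum-cong-≗ (λ v → walkIf-sym (pair? u v) x y))
      ; E⇒adj = F⇒adj
      ; E-odd = F-odd
      }

-- Decreasing the number of edges of an odd spanning subgraph

sum-mono-≤ : ∀ {f g : Fin n → ℕ} → (∀ i → f i ≤ g i) → sum f ≤ sum g
sum-mono-≤ {zero}  f≤g = z≤n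
sum-mono-≤ {suc n} f≤g = +-mono-≤ (f≤g zero) (sum-mono-≤ (f≤g ∘ suc))

sum-mono-< : ∀ {f g : Fin n → ℕ} → (∀ i → f i ≤ g i) → ∀ i → f i < g i → sum f < sum g
sum-mono-< f≤g zero    f<g = +-mono-<-≤ f<g (sum-mono-≤ (f≤g ∘ suc))
sum-mono-< f≤g (suc i) f<g = +-mono-≤-< (f≤g zero) (sum-mono-< (f≤g ∘ suc) i f<g)

∣p∪q∣≤∣p∣+∣q∣ : ∀ (p q : Subset n) → ∣ p ∪ q ∣ ≤ ∣ p ∣ + ∣ q ∣
∣p∪q∣≤∣p∣+∣q∣ []          []          = z≤n
∣p∪q∣≤∣p∣+∣q∣ (false ∷ p) (false ∷ q) = ∣p∪q∣≤∣p∣+∣q∣ p q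
∣p∪q∣≤∣p∣+∣q∣ (false ∷ p) (true ∷ q)  = ≤-trans (s≤s (∣p∪q∣≤∣p∣+∣q∣ p q)) (≤-reflexive (sym (+-suc ∣ p ∣ ∣ q ∣)))
∣p∪q∣≤∣p∣+∣q∣ (true ∷ p)  (false ∷ q) = s≤s (∣p∪q∣≤∣p∣+∣q∣ p q)
∣p∪q∣≤∣p∣+∣q∣ (true ∷ p)  (true ∷ q)  = s≤s (≤-trans (∣p∪q∣≤∣p∣+∣q∣ p q) (+-monoʳ-≤ ∣ p ∣ (m≤n⇒m≤1+n ≤-refl)))

-- The loss of `a` pays for the possible gain of `b`. This bounds the rows of `u` and `v` in a
-- shortcut: each loses an edge of the walk and gains at most the new edge.
exchange-≤ : ∀ {p q : Subset n} {a b} → a ∈ q → p ⊆ (q - a) ∪ ⁅ b ⁆ → ∣ p ∣ ≤ ∣ q ∣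
exchange-≤ {p = p} {q} {a} {b} a∈q p⊆ = begin
  ∣ p ∣                    ≤⟨ p⊆q⇒∣p∣≤∣q∣ p⊆ ⟩
  ∣ (q - a) ∪ ⁅ b ⁆ ∣      ≤⟨ ∣p∪q∣≤∣p∣+∣q∣ (q - a) ⁅ b ⁆ ⟩
  ∣ q - a ∣ + ∣ ⁅ b ⁆ ∣    ≡⟨ cong (λ j → (∣ q - a ∣) + j) (∣⁅x⁆∣≡1 b) ⟩
  (∣ q - a ∣) + 1          ≡⟨ +-comm (∣ q - a ∣) 1 ⟩
  suc (∣ q - a ∣)          ≤⟨ x∈p⇒∣p-x∣<∣p∣ a∈q ⟩
  ∣ q ∣                    ∎
  where open ≤-Reasoning

-- Twice the number of edges, since each edge is counted at both ends.
size : ∀ {G : Graph n} → OddSpanning G → ℕ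
size H = sum (λ x → ∣ tabulate (E H x) ∣)

Induced : ∀ {G : Graph n} → OddSpanning G → Set
Induced {G = G} H = ∀ {u v} → _∼_ H u v → Adj G u v → E H u v ≡ true

-- Replacing the edges of a walk in H from u to v by the single edge uv keeps all degrees
-- odd. The walk has an edge at u and one at v, distinct since uv ∉ H, so H gets smaller.
module _ {G : Graph n} (H : OddSpanning G) {u v : Fin n}
         (w : _∼_ H u v) (u—v : Adj G u v) (uv∉E : E H u v ≡ false) where

  private
    W E′ : EdgeSet n
    W = edgesOf w
    E′ x y = (E H x y xor W x y) xor edge u v x y

    W⇒E : ∀ {x y} → W x y ≡ true → E H x y ≡ true
    W⇒E = edgesOf⇒R (λ {x} {y} e → trans (E-sym H y x) e) w

    -- As `W` is contained in `E H`, their symmetric difference is the difference `E H` without `W`.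
    E′-cases : ∀ {x y} → E′ x y ≡ true → (E H x y ≡ true × W x y ≡ false) ⊎ edge u v x y ≡ true
    E′-cases {x} {y} eq with xor-true {E H x y xor W x y} eq
    ... | inj₂ (_ , e) = inj₂ e
    ... | inj₁ (e , _) with xor-true {E H x y} e
    ...   | inj₁ p         = inj₁ p
    ...   | inj₂ (¬e , Wxy) = contradiction (trans (sym (W⇒E Wxy)) ¬e) λ ()

    E′⇒adj : ∀ {x y} → E′ x y ≡ true → Adj G x y
    E′⇒adj {x} {y} eq with E′-cases {x} {y} eq
    ... | inj₁ (e , _) = E⇒adj H e
    ... | inj₂ e with edge⇒ends {a = u} {v} {x} {y} e
    ...   | inj₁ (refl , refl) = u—v
    ...   | inj₂ (refl , refl) = symmetric G u—v

    ⨁-E′ : ∀ x → ⨁ (E′ x) ≡ true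
    ⨁-E′ x = begin
      ⨁ (E′ x)
        ≡⟨ ∑-distrib-+ (λ y → E H x y xor W x y) (edge u v x) ⟩
      ⨁ (λ y → E H x y xor W x y) xor ⨁ (edge u v x)
        ≡⟨ cong₂ _xor_ (∑-distrib-+ (E H x) (W x)) (⨁-edge u v x) ⟩
      (⨁ (E H x) xor ⨁ (W x)) xor (δ x u xor δ x v)
        ≡⟨ cong₂ (λ a b → (a xor b) xor (δ x u xor δ x v)) (E-odd H x) (⨁-edgesOf w x) ⟩
      (true xor (δ x u xor δ x v)) xor (δ x u xor δ x v)
        ≡⟨ not-xor-same (δ x u xor δ x v) ⟩
      true ∎
      where
      open ≡-Reasoning
      not-xor-same : ∀ b → not b xor b ≡ true
      not-xor-same true  = refl
      not-xor-same false = refl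

    u≢v : u ≢ v
    u≢v refl = loopless G u u—v

    -- Repeated edges cancel in `W`, so the first edge of the walk may be lost; but `u ≢ v` makes
    -- the degree at `u` odd, hence nonzero.
    W-at-u : ∃ λ a → W u a ≡ true
    W-at-u = ⨁≡true⇒∃ (trans (⨁-edgesOf w u) (cong₂ _xor_ (δ-refl u) (dec-false (u ≟ v) u≢v)))

    W-at-v : ∃ λ a → W v a ≡ true
    W-at-v = ⨁≡true⇒∃ (trans (⨁-edgesOf w v) (cong₂ _xor_ (dec-false (v ≟ u) (u≢v ∘ sym)) (δ-refl v)))

    end-row : ∀ s t → (∃ λ a → W s a ≡ true) → (∀ {y} → edge u v s y ≡ true → y ≡ t) →
              ∣ tabulate (E′ s) ∣ ≤ ∣ tabulate (E H s) ∣
    end-row s t (a , Wsa) to-t = exchange-≤ {a = a} {t} (∈-tabulate⁺ (W⇒E Wsa)) step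
      where
      step : tabulate (E′ s) ⊆ (tabulate (E H s) - a) ∪ ⁅ t ⁆
      step {y} y∈ with E′-cases {s} {y} (∈-tabulate⁻ y∈)
      ... | inj₁ (e , ¬W) = x∈p∪q⁺ (inj₁ (x∈p∧x≢y⇒x∈p-y (∈-tabulate⁺ e)
                              (λ { refl → contradiction (trans (sym Wsa) ¬W) λ () })))
      ... | inj₂ e = x∈p∪q⁺ (inj₂ (subst (y ∈_) (cong ⁅_⁆ (to-t e)) (x∈⁅x⁆ y)))

    off-ends : ∀ {x y} → x ≢ u → x ≢ v → E′ x y ≡ true → E H x y ≡ true × W x y ≡ false
    off-ends {x} {y} x≢u x≢v eq with E′-cases {x} {y} eq
    ... | inj₁ p = p
    ... | inj₂ e = [ (λ q → contradiction (proj₁ q) x≢u) , (λ q → contradiction (proj₁ q) x≢v) ]′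
                     (edge⇒ends {a = u} {v} {x} {y} e)

    row-⊆ : ∀ {x} → x ≢ u → x ≢ v → tabulate (E′ x) ⊆ tabulate (E H x)
    row-⊆ {x} x≢u x≢v y∈ = ∈-tabulate⁺ (proj₁ (off-ends {x} x≢u x≢v (∈-tabulate⁻ y∈)))

    row-≤ : ∀ x → Dec (x ≡ u) → Dec (x ≡ v) → ∣ tabulate (E′ x) ∣ ≤ ∣ tabulate (E H x) ∣
    row-≤ x (yes refl) _ = end-row u v W-at-u
      (λ {y} e → [ proj₂ , (λ q → contradiction (proj₁ q) u≢v) ]′ (edge⇒ends {a = u} {v} {u} {y} e))
    row-≤ x (no _) (yes refl) = end-row v u W-at-v
      (λ {y} e → [ (λ q → contradiction (sym (proj₁ q)) u≢v) , proj₂ ]′ (edge⇒ends {a = u} {v} {v} {y} e))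
    row-≤ x (no x≢u) (no x≢v) = p⊆q⇒∣p∣≤∣q∣ (row-⊆ x≢u x≢v)

    -- The `W`-neighbour `a` of `u` is not `v`, because `uv` is not in `E H`. So the row of `a`
    -- loses the entry `u` and gains nothing.
    row-< : ∃ λ x → ∣ tabulate (E′ x) ∣ < ∣ tabulate (E H x) ∣
    row-< with W-at-u
    ... | a , Wua = a , p⊂q⇒∣p∣<∣q∣ (row-⊆ a≢u a≢v , u , ∈-tabulate⁺ (trans (E-sym H a u) (W⇒E Wua)) , u∉)
      where
      a≢u : a ≢ u
      a≢u refl = loopless G a (E⇒adj H (W⇒E Wua))
      a≢v : a ≢ v
      a≢v refl = contradiction (trans (sym (W⇒E Wua)) uv∉E) λ ()
      u∉ : ¬ u ∈ tabulate (E′ a)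
      u∉ u∈ = contradiction (trans (sym Wua)
        (trans (edgesOf-sym w u a) (proj₂ (off-ends {a} a≢u a≢v (∈-tabulate⁻ u∈))))) λ ()

  shortcut : ∃ λ (H′ : OddSpanning G) → size H′ < size H
  shortcut = record
    { E     = E′
    ; E-sym = λ x y → cong₂ _xor_ (cong₂ _xor_ (E-sym H x y) (edgesOf-sym w x y)) (edge-sym u v x y)
    ; E⇒adj = λ {x} {y} → E′⇒adj {x} {y}
    ; E-odd = ⨁-E′
    } , sum-mono-< (λ x → row-≤ x (x ≟ u) (x ≟ v)) (proj₁ row-<) (proj₂ row-<)

abstract
  -- Each shortcut decreases `size`, so shortcuts cannot go on forever; when no pair `u`, `v` admits
  -- one, the components are induced.
  inducedOddSpanning : ∀ {G : Graph n} → OddSpanning G → ∃ λ (H : OddSpanning G) → Induced H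
  inducedOddSpanning {G = G} H₀ = go H₀ (<-wellFounded (size H₀))
    where
    go : ∀ (H : OddSpanning G) → Acc _<_ (size H) → ∃ λ (H : OddSpanning G) → Induced H
    go H (acc rs) with any? (λ u → any? (λ v → _∼?_ H u v ×-dec (adj? G u v ×-dec (E H u v ≟ᵇ false))))
    ... | yes (u , v , w , u—v , uv∉E) with shortcut H w u—v uv∉E
    ...   | H′ , H′<H = go H′ (rs H′<H)
    go H (acc rs) | no none = H , λ {u} {v} w u—v → ¬-not (λ uv∉E → none (u , v , w , u—v , uv∉E))

-- Trees

-- The list holds the vertices after the start, end included, so `a ∷ xs` lists the path in the form
-- that `HasCycle` expects.
data Path {m} (R : Rel (Fin m) 0ℓ) : Fin m → List (Fin m) → Fin m → Set where
  []  : ∀ {a} → Path R a [] a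
  _∷_ : ∀ {a b c xs} → R a b → Path R b xs c → Path R a (b ∷ xs) c

module _ {m} {R : Rel (Fin m) 0ℓ} where

  suffix : ∀ {a b c xs} → a ∈ₗ (b ∷ xs) → Path R b xs c → Unique (b ∷ xs) →
           ∃ λ ys → Path R a ys c × Unique (a ∷ ys)
  suffix (here refl) p       u       = _ , p , u
  suffix (there a∈)  (_ ∷ p) (_ ∷ u) = suffix a∈ p u

  loopErase : ∀ {a c} → Star R a c → ∃ λ xs → Path R a xs c × Unique (a ∷ xs)
  loopErase ε = [] , [] , [] ∷ []
  loopErase {a} (_◅_ {j = b} r w) with loopErase w
  ... | xs , p , u with anyₗ? (a ≟_) (b ∷ xs)
  ...   | yes a∈ = suffix a∈ p u
  ...   | no a∉  = b ∷ xs , r ∷ p , ¬Any⇒All¬ _ a∉ ∷ u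

  closePath : ∀ {T : Rel (Fin m) 0ℓ} → (∀ {x y} → R x y → T x y) →
              ∀ {a b c xs} → Path R a xs b → T b c → Linked T (a ∷ (xs ∷ʳ c))
  closePath R⇒T []      t = t ∷ [-]
  closePath R⇒T (r ∷ p) t = R⇒T r ∷ closePath R⇒T p t

-- After loop erasure the walk is a simple path. Length 0 would be a loop and length 1 the forbidden
-- step, so it has at least two steps and the edge from `b` to `a` closes it to a cycle.
no-detour : ∀ {m} {T : Graph m} → ¬ HasCycle T → ∀ {a b} → Adj T a b →
            ¬ Star (λ x y → Adj T x y × ¬ (x ≡ a × y ≡ b)) a b
no-detour {T = T} acyclic {a} {b} a—b w with loopErase w
... | []         , []           , _ = loopless T a a—b
... | _ ∷ []     , (_ , r) ∷ [] , _ = r (refl , refl)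
... | y ∷ z ∷ xs , p            , u =
  acyclic (a , y ∷ z ∷ xs , s≤s (s≤s z≤n) , u , closePath proj₁ p (symmetric T a—b))

exitEdge : ∀ {m} {R : Rel (Fin m) 0ℓ} (S : Subset m) {a b} → a ∈ S → b ∉ S → Star R a b →
           ∃₂ λ p t → p ∈ S × t ∉ S × R p t
exitEdge S a∈ b∉ ε = contradiction a∈ b∉
exitEdge S {a} a∈ b∉ (_◅_ {j = c} r w) with c ∈? S
... | yes c∈ = exitEdge S c∈ b∉ w
... | no c∉  = a , c , a∈ , c∉ , r

-- The edge p t is the only one between S and the part of the tree beyond t.
module _ {m} {T : Graph m} (acyclic : ¬ HasCycle T) (S : Subset m)
         (linked : ∀ {s s′} → s ∈ S → s′ ∈ S → Star (λ a b → b ∈ S × Adj T a b) s s′)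
         {p t : Fin m} (p∈S : p ∈ S) (t∉S : t ∉ S) (p—t : Adj T p t)
         {X : Fin m → Set} where

  entry-via-parent : ∀ {a s} → Star (λ a b → a ∉ S × Adj T a b) a t → a ∉ S →
                     Star (λ a b → X a × X b × Adj T a b) a s → s ∈ S → X p
  entry-via-parent back a∉ ε s∈ = contradiction s∈ a∉
  entry-via-parent {a} back a∉ (_◅_ {j = b} (_ , Xb , a—b) w) s∈ with b ∈? S
  ... | no b∉  = entry-via-parent ((b∉ , symmetric T a—b) ◅ back) b∉ w s∈
  ... | yes b∈ with b ≟ p ×-dec a ≟ t
  ...   | yes (refl , _) = Xb
  -- From `p` to `b` inside `S`, across the step from `b` to `a`, then by `back` to `t` outside `S`:
  -- a detour around the edge `p t`.
  ...   | no ≢pt = contradiction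
            (mapStar (λ { (b∈ , e) → e , λ { (_ , refl) → t∉S b∈ } }) (linked p∈S b∈)
              ◅◅ (symmetric T a—b , ≢pt)
              ◅ mapStar (λ { (a∉ , e) → e , λ { (refl , _) → a∉ p∈S } }) back)
            (no-detour {T = T} acyclic p—t)

-- Colouring the classes of a tree decomposition

injection-≤ : ∀ {k} (f : Fin k → Fin n) → (∀ {i j} → f i ≡ f j → i ≡ j) →
              ∀ p → (∀ i → f i ∈ p) → k ≤ ∣ p ∣
injection-≤ {k = zero}  f inj p f∈ = z≤n
injection-≤ {k = suc k} f inj p f∈ = ≤-trans
  (s≤s (injection-≤ (f ∘ suc) (suc-injective ∘ inj) (p - f zero)
    (λ i → x∈p∧x≢y⇒x∈p-y (f∈ (suc i)) (λ eq → contradiction (inj eq) λ ()))))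
  (x∈p⇒∣p-x∣<∣p∣ (f∈ zero))

-- Pigeonhole: `p - z` has fewer than `k` elements. If every colour occurred there, choosing a
-- vertex of each colour would inject `Fin k` into `p - z`.
freshColour : ∀ {k} (col : Fin n → Fin k) {p z} → z ∈ p → ∣ p ∣ ≤ k →
              ∃ λ c → ∀ {y} → y ∈ p → y ≢ z → col y ≢ c
freshColour {k = k} col {p} {z} z∈p p≤k with any? (λ c → ¬? (used? c))
  where
  used? : ∀ c → Dec (∃ λ y → y ∈ p - z × col y ≡ c)
  used? c = any? (λ y → (y ∈? (p - z)) ×-dec (col y ≟ c))
... | yes (c , unused) = c , λ y∈p y≢z eq → unused (_ , x∈p∧x≢y⇒x∈p-y y∈p y≢z , eq)
... | no none = contradiction
      (≤-<-trans (injection-≤ (proj₁ ∘ used) inj (p - z) (proj₁ ∘ proj₂ ∘ used))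
                 (<-≤-trans (x∈p⇒∣p-x∣<∣p∣ z∈p) p≤k))
      (<-irrefl refl)
  where
  used : ∀ c → ∃ λ y → y ∈ p - z × col y ≡ c
  used c = decidable-stable (any? (λ y → (y ∈? (p - z)) ×-dec (col y ≟ c))) (λ u → none (c , u))
  inj : ∀ {i j} → proj₁ (used i) ≡ proj₁ (used j) → i ≡ j
  inj {i} {j} eq = trans (sym (proj₂ (proj₂ (used i)))) (trans (cong col eq) (proj₂ (proj₂ (used j))))

module ClassColouring {G : Graph n} (H : OddSpanning G) (D : TreeDecomposition G)
                      {k} (bags≤k : ∀ t → ∣ TreeDecomposition.bag D t ∣ ≤ k) where

  open TreeDecomposition D renaming (size to m)
  open OddSpanning H using () renaming (_∼_ to _≈_; _∼?_ to _≈?_; ∼-sym to ≈-sym)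

  -- The contracted graph is never formed. `Meets x t` says that the class of `x`, a component of
  -- `H`, would lie in the contracted bag at `t`.
  Meets : Fin n → Fin m → Set
  Meets x t = ∃ λ y → x ≈ y × y ∈ bag t

  meets? : ∀ x t → Dec (Meets x t)
  meets? x t = any? (λ y → (x ≈? y) ×-dec (y ∈? bag t))

  MeetsWalk : Fin n → Fin m → Fin m → Set
  MeetsWalk x = Star (λ a b → Meets x a × Meets x b × Adj tree a b)

  -- Consecutive vertices of a walk in `H` share a bag, so the connected node sets of the vertices
  -- of a class overlap along the walk.
  class-connected : ∀ {x s t} → Meets x s → Meets x t → MeetsWalk x s t
  class-connected {x} (y , x≈y , y∈s) (z , x≈z , z∈t) = go x≈y (≈-sym x≈y ◅◅ x≈z) y∈s z∈t
    where
    in-bags : ∀ {y s t} → x ≈ y → y ∈ bag s → y ∈ bag t → MeetsWalk x s t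
    in-bags {y} {s} {t} x≈y y∈s y∈t =
      mapStar (λ { (y∈a , y∈b , e) → (y , x≈y , y∈a) , (y , x≈y , y∈b) , e })
        (nodesConnected y s t y∈s y∈t)
    go : ∀ {y z s t} → x ≈ y → y ≈ z → y ∈ bag s → z ∈ bag t → MeetsWalk x s t
    go x≈y ε y∈s z∈t = in-bags x≈y y∈s z∈t
    go {y} x≈y (_◅_ {j = y′} e y′≈z) y∈s z∈t with coversEdges y y′ (E⇒adj H e)
    ... | r , y∈r , y′∈r = in-bags x≈y y∈s y∈r ◅◅ go (x≈y ◅◅ e ◅ ε) y′≈z y′∈r z∈t

  Respects : (Fin n → Fin k) → Set
  Respects col = ∀ {x y} → x ≈ y → col x ≡ col y

  -- Stronger than properness on the contracted graph: any two classes that share the bag, adjacent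
  -- or not, get different colours.
  Separates : (Fin n → Fin k) → Fin m → Set
  Separates col t = ∀ {x y} → x ∈ bag t → y ∈ bag t → col x ≡ col y → x ≈ y

  Colouring : Subset m → Set
  Colouring S = ∃ λ col → Respects col × (∀ {s} → s ∈ S → Separates col s)

  module _ (S : Subset m) (t : Fin m) where

    Old : Fin n → Set
    Old x = ∃ λ s → s ∈ S × Meets x s

    -- The vertices whose colours are settled while the bag at `t` is processed: those handled so
    -- far, in `L`, and those whose class occurs at a node of `S`.
    Seen : List (Fin n) → Fin n → Set
    Seen L x = x ∈ₗ L ⊎ Old x

    seen? : ∀ L x → Dec (Seen L x)
    seen? L x = anyₗ? (x ≟_) L ⊎-dec any? (λ s → (s ∈? S) ×-dec meets? x s)

    SeparatesSeen : List (Fin n) → (Fin n → Fin k) → Set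
    SeparatesSeen L col = ∀ {x y} → x ∈ bag t → y ∈ bag t → Seen L x → Seen L y → col x ≡ col y → x ≈ y

    -- Outside the bag, `z` imposes nothing. If its class has a seen member in the bag, its colour
    -- is settled. Otherwise the whole class gets a colour missing from the rest of the bag; it
    -- meets no bag in `S`, as `z` would then be seen, so the separation there persists.
    colour-vertex : ∀ z L → ((col , _) : Colouring S) → SeparatesSeen L col →
                    ∃ λ ((col , _) : Colouring S) → SeparatesSeen (z ∷ L) col
    colour-vertex z L C@(col , resp , sep) sepL with z ∈? bag t
    ... | no z∉t = C , λ x∈ y∈ sx sy → sepL x∈ y∈ (drop x∈ sx) (drop y∈ sy)
      where
      drop : ∀ {x} → x ∈ bag t → Seen (z ∷ L) x → Seen L x
      drop x∈ (inj₁ (here refl)) = contradiction x∈ z∉t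
      drop x∈ (inj₁ (there x∈L)) = inj₁ x∈L
      drop x∈ (inj₂ o)           = inj₂ o
    ... | yes z∈t with any? (λ w → (w ∈? bag t) ×-dec (z ≈? w) ×-dec seen? L w)
    ...   | yes (w , w∈t , z≈w , seen-w) = C , λ x∈ y∈ sx sy eq →
              let (x′ , x≈x′ , x′∈ , sx′) = move x∈ sx
                  (y′ , y≈y′ , y′∈ , sy′) = move y∈ sy
              in x≈x′ ◅◅ sepL x′∈ y′∈ sx′ sy′ (trans (sym (resp x≈x′)) (trans eq (resp y≈y′))) ◅◅ ≈-sym y≈y′
      where
      move : ∀ {x} → x ∈ bag t → Seen (z ∷ L) x → ∃ λ x′ → x ≈ x′ × x′ ∈ bag t × Seen L x′
      move x∈ (inj₁ (here refl)) = w , z≈w , w∈t , seen-w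
      move x∈ (inj₁ (there x∈L)) = _ , ε , x∈ , inj₁ x∈L
      move x∈ (inj₂ o)           = _ , ε , x∈ , inj₂ o
    ...   | no new with freshColour col z∈t (bags≤k t)
    ...     | c , fresh = (col′ , resp′ , sep′) , sepL′
      where
      paint : ∀ {y} → Dec (z ≈ y) → Fin k
      paint {y} (yes _) = c
      paint {y} (no _)  = col y

      col′ : Fin n → Fin k
      col′ y = paint (z ≈? y)

      painted : ∀ {y} → z ≈ y → col′ y ≡ c
      painted {y} z≈y with z ≈? y
      ... | yes _  = refl
      ... | no z≉y = contradiction z≈y z≉y

      unpainted : ∀ {y} → ¬ z ≈ y → col′ y ≡ col y
      unpainted {y} z≉y with z ≈? y
      ... | yes z≈y = contradiction z≈y z≉y
      ... | no _    = refl

      resp′ : Respects col′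
      resp′ {x} {y} x≈y = helper (z ≈? x)
        where
        helper : Dec (z ≈ x) → col′ x ≡ col′ y
        helper (yes z≈x) = trans (painted z≈x) (sym (painted (z≈x ◅◅ x≈y)))
        helper (no z≉x)  = trans (unpainted z≉x) (trans (resp x≈y)
                             (sym (unpainted (λ z≈y → z≉x (z≈y ◅◅ ≈-sym x≈y)))))

      not-old : ∀ {s x} → s ∈ S → x ∈ bag s → ¬ z ≈ x
      not-old {s} {x} s∈ x∈ z≈x = new (z , z∈t , ε , inj₂ (s , s∈ , x , z≈x , x∈))

      sep′ : ∀ {s} → s ∈ S → Separates col′ s
      sep′ s∈ x∈ y∈ eq = sep s∈ x∈ y∈
        (trans (sym (unpainted (not-old s∈ x∈))) (trans eq (unpainted (not-old s∈ y∈))))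

      not-seen : ∀ {x} → x ∈ bag t → Seen L x → ¬ z ≈ x
      not-seen x∈ sx z≈x = new (_ , x∈ , z≈x , sx)

      avoids : ∀ {y} → y ∈ bag t → Seen L y → col′ y ≢ col′ z
      avoids y∈ sy eq = fresh y∈ (λ { refl → not-seen y∈ sy ε })
        (trans (sym (unpainted (not-seen y∈ sy))) (trans eq (painted ε)))

      split : ∀ {x} → Seen (z ∷ L) x → x ≡ z ⊎ Seen L x
      split (inj₁ (here eq))   = inj₁ eq
      split (inj₁ (there x∈L)) = inj₂ (inj₁ x∈L)
      split (inj₂ o)           = inj₂ (inj₂ o)

      sepL′ : SeparatesSeen (z ∷ L) col′
      sepL′ x∈ y∈ sx sy eq with split sx | split sy
      ... | inj₁ refl | inj₁ refl = ε
      ... | inj₁ refl | inj₂ sy′  = contradiction (sym eq) (avoids y∈ sy′)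
      ... | inj₂ sx′  | inj₁ refl = contradiction eq (avoids x∈ sx′)
      ... | inj₂ sx′  | inj₂ sy′  = sepL x∈ y∈ sx′ sy′
              (trans (sym (unpainted (not-seen x∈ sx′))) (trans eq (unpainted (not-seen y∈ sy′))))

    colour-vertices : ∀ L → ((col , _) : Colouring S) → SeparatesSeen [] col →
                      ∃ λ ((col , _) : Colouring S) → SeparatesSeen L col
    colour-vertices []      C sep = C , sep
    colour-vertices (z ∷ L) C sep with colour-vertices L C sep
    ... | C′ , sep′ = colour-vertex z L C′ sep′

    colour-node : ((col , _) : Colouring S) →
                  (∀ {x y} → x ∈ bag t → y ∈ bag t → Old x → Old y → col x ≡ col y → x ≈ y) →
                  Colouring (S ∪ ⁅ t ⁆)
    colour-node C old-sep with colour-vertices (allFin n) C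
      (λ { x∈ y∈ (inj₂ ox) (inj₂ oy) → old-sep x∈ y∈ ox oy })
    ... | (col , resp , sep) , sepAll = col , resp , λ s∈ → [ sep , at-t ]′ (x∈p∪q⁻ S ⁅ t ⁆ s∈)
      where
      at-t : ∀ {s} → s ∈ ⁅ t ⁆ → Separates col s
      at-t s∈ x∈ y∈ with x∈⁅y⁆⇒x≡y t s∈
      ... | refl = sepAll x∈ y∈ (inj₁ (∈-allFin _)) (inj₁ (∈-allFin _))

  open IsTree isTree

  Linked-in : Subset m → Set
  Linked-in S = ∀ {s s′} → s ∈ S → s′ ∈ S → Star (λ a b → b ∈ S × Adj tree a b) s s′

  linked-∪ : ∀ {S p t} → Linked-in S → p ∈ S → Adj tree p t → Linked-in (S ∪ ⁅ t ⁆)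
  linked-∪ {S} {p} {t} link p∈ p—t s∈ s′∈ = walk (x∈p∪q⁻ S ⁅ t ⁆ s∈) (x∈p∪q⁻ S ⁅ t ⁆ s′∈)
    where
    widen : ∀ {a b} → Star (λ a b → b ∈ S × Adj tree a b) a b → Star (λ a b → b ∈ S ∪ ⁅ t ⁆ × Adj tree a b) a b
    widen = mapStar (λ { (b∈ , e) → p⊆p∪q ⁅ t ⁆ b∈ , e })
    in-step : (t ∈ S ∪ ⁅ t ⁆) × Adj tree p t
    in-step = q⊆p∪q S ⁅ t ⁆ (x∈⁅x⁆ t) , p—t
    out-step : (p ∈ S ∪ ⁅ t ⁆) × Adj tree t p
    out-step = p⊆p∪q ⁅ t ⁆ p∈ , symmetric tree p—t
    walk : ∀ {s s′} → s ∈ S ⊎ s ∈ ⁅ t ⁆ → s′ ∈ S ⊎ s′ ∈ ⁅ t ⁆ → Star (λ a b → b ∈ S ∪ ⁅ t ⁆ × Adj tree a b) s s′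
    walk (inj₁ s∈) (inj₁ s′∈) = widen (link s∈ s′∈)
    walk (inj₁ s∈) (inj₂ s′∈) with x∈⁅y⁆⇒x≡y t s′∈
    ... | refl = widen (link s∈ p∈) ◅◅ in-step ◅ ε
    walk (inj₂ s∈) (inj₁ s′∈) with x∈⁅y⁆⇒x≡y t s∈
    ... | refl = out-step ◅ widen (link p∈ s′∈)
    walk (inj₂ s∈) (inj₂ s′∈) with x∈⁅y⁆⇒x≡y t s∈ | x∈⁅y⁆⇒x≡y t s′∈
    ... | refl | refl = ε

  -- The tree is explored from the root, each new node `t` being adjacent to some `p` in `S`. A
  -- class that meets the bag at `t` and a bag in `S` also meets the bag at `p`, since its nodes are
  -- connected and `p t` is the only way into `S`. So the old classes at `t` are already separated
  -- at `p`.
  grow : ∀ S → Acc _⊃_ S → root ∈ S → Linked-in S → Colouring S →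
         ∃ λ col → Respects col × (∀ t → Separates col t)
  grow S (acc rs) root∈ link C@(col , resp , sep) with any? (λ t → ¬? (t ∈? S))
  ... | no all∈ = col , resp , λ t → sep (decidable-stable (t ∈? S) (λ t∉ → all∈ (t , t∉)))
  ... | yes (t₀ , t₀∉) with exitEdge S root∈ t₀∉ (connected root t₀)
  ...   | p , t , p∈ , t∉ , p—t = grow (S ∪ ⁅ t ⁆)
            (rs (p⊆p∪q ⁅ t ⁆ , t , q⊆p∪q S ⁅ t ⁆ (x∈⁅x⁆ t) , t∉))
            (p⊆p∪q ⁅ t ⁆ root∈) (linked-∪ link p∈ p—t) (colour-node S t C old-sep)
    where
    meets-parent : ∀ {x} → x ∈ bag t → Old S t x → Meets x p
    meets-parent x∈ (s , s∈ , x-s) =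
      entry-via-parent {T = tree} acyclic S link p∈ t∉ p—t {X = Meets _} ε t∉ (class-connected (_ , ε , x∈) x-s) s∈
    old-sep : ∀ {x y} → x ∈ bag t → y ∈ bag t → Old S t x → Old S t y → col x ≡ col y → x ≈ y
    old-sep x∈ y∈ ox oy eq with meets-parent x∈ ox | meets-parent y∈ oy
    ... | x′ , x≈x′ , x′∈ | y′ , y≈y′ , y′∈ =
      x≈x′ ◅◅ sep p∈ x′∈ y′∈ (trans (sym (resp x≈x′)) (trans eq (resp y≈y′))) ◅◅ ≈-sym y≈y′

  -- `Fin k` may be empty, but then there are no vertices: a vertex lies in some bag and so forces
  -- `0 < k`.
  constantColouring : ∀ k → (Fin n → 0 < k) → Σ (Fin n → Fin k) λ col → ∀ x y → col x ≡ col y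
  constantColouring zero    pos = (λ v → contradiction (pos v) λ ()) , λ x → contradiction (pos x) λ ()
  constantColouring (suc k) pos = (λ _ → zero) , λ _ _ → refl

  initial : Colouring ⊥
  initial with constantColouring k (λ v → let (t , v∈t) = coversVertices v in
                 ≤-trans (≤-<-trans z≤n (x∈p⇒∣p-x∣<∣p∣ v∈t)) (bags≤k t))
  ... | col , const = col , (λ {x} {y} _ → const x y) , λ s∈ → contradiction s∈ ∉⊥

  abstract
    classColouring : ∃ λ col → Respects col × (∀ t → Separates col t)
    classColouring = grow (⊥ ∪ ⁅ root ⁆) (⊃-wellFounded _) (q⊆p∪q ⊥ ⁅ root ⁆ (x∈⁅x⁆ root)) linked
      (colour-node ⊥ root initial (λ { _ _ (_ , s∈ , _) → contradiction s∈ ∉⊥ }))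
      where
      only-root : ∀ {s} → s ∈ ⊥ ∪ ⁅ root ⁆ → s ≡ root
      only-root s∈ = [ (λ s∈⊥ → contradiction s∈⊥ ∉⊥) , x∈⁅y⁆⇒x≡y root ]′ (x∈p∪q⁻ ⊥ ⁅ root ⁆ s∈)
      linked : Linked-in (⊥ ∪ ⁅ root ⁆)
      linked s∈ s′∈ with only-root s∈ | only-root s′∈
      ... | refl | refl = ε

-- Odd colourings

-- An odd partition in which empty parts are allowed, with degrees read modulo 2.
IsOddColouring : ∀ (G : Graph n) {k} → (Fin n → Fin k) → Set
IsOddColouring G col = ∀ v → ⨁ (λ u → lookup (N G v) u ∧ δ (col u) (col v)) ≡ true

OddColouring : Graph n → ℕ → Set
OddColouring {n} G k = Σ (Fin n → Fin k) (IsOddColouring G)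

isOddColouring-cong : ∀ (G : Graph n) {k l} (f : Fin n → Fin k) (g : Fin n → Fin l) →
                      (∀ u v → δ (f u) (f v) ≡ δ (g u) (g v)) → IsOddColouring G f → IsOddColouring G g
isOddColouring-cong G f g eq odd v =
  trans (sum-cong-≗ (λ u → cong (lookup (N G v) u ∧_) (sym (eq u v)))) (odd v)

-- Exhaustive search over colourings, coded as vectors, makes their existence decidable, so that
-- `least` can find the smallest number of colours.
anyVec? : ∀ {k n} {P : Vec (Fin k) n → Set} → (∀ xs → Dec (P xs)) → Dec (∃ P)
anyVec? {n = zero}  P? = map′ ([] ,_) (λ { ([] , p) → p }) (P? [])
anyVec? {n = suc n} P? = map′ (λ { (x , xs , p) → x ∷ xs , p }) (λ { (x ∷ xs , p) → x , xs , p })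
  (any? (λ x → anyVec? (λ xs → P? (x ∷ xs))))

oddColouring? : ∀ (G : Graph n) k → Dec (OddColouring G k)
oddColouring? G k = map′
  (λ { (xs , odd) → lookup xs , odd })
  (λ { (col , odd) → tabulate col , isOddColouring-cong G col (lookup (tabulate col))
         (λ u v → sym (cong₂ δ (lookup∘tabulate col u) (lookup∘tabulate col v))) odd })
  (anyVec? (λ xs → all? (λ v → ⨁ (λ u → lookup (N G v) u ∧ δ (lookup xs u) (lookup xs v)) ≟ᵇ true)))

≡true-ext : ∀ {a b} → (a ≡ true → b ≡ true) → (b ≡ true → a ≡ true) → a ≡ b
≡true-ext {true}          f g = sym (f refl)
≡true-ext {false} {true}  f g = g refl
≡true-ext {false} {false} f g = refl

lookup-∩ : ∀ (p q : Subset n) i → lookup (p ∩ q) i ≡ lookup p i ∧ lookup q i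
lookup-∩ p q i = lookup-zipWith _∧_ i p q

partition⇒colouring : ∀ {G : Graph n} {d} → OddPartition G d → OddColouring G d
partition⇒colouring {n} {G} {d} P = col , isOdd
  where
  open OddPartition P
  col : Fin n → Fin d
  col v = proj₁ (partition v)
  ∈-part : ∀ u i → lookup (part i) u ≡ δ (col u) i
  ∈-part u i = ≡true-ext
    (λ u∈ → dec-true (col u ≟ i) (proj₂ (proj₂ (partition u)) (lookup⇒[]= u (part i) u∈)))
    (λ eq → []=⇒lookup (subst (λ i → u ∈ part i) (does-true (col u ≟ i) eq) (proj₁ (proj₂ (partition u)))))
  isOdd : IsOddColouring G col
  isOdd v = trans
    (sum-cong-≗ (λ u → sym (trans (lookup-∩ (N G v) (part (col v)) u)
                                  (cong (lookup (N G v) u ∧_) (∈-part u (col v))))))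
    (odd⇒⨁≡true (N G v ∩ part (col v)) (odd (col v) v (proj₁ (proj₂ (partition v)))))

surjectiveColouring⇒partition : ∀ {G : Graph n} {k} ((col , _) : OddColouring G k) →
                                (∀ i → ∃ λ v → col v ≡ i) → OddPartition G k
surjectiveColouring⇒partition {n} {G} {k} (col , isOdd) surj = record
  { part      = class
  ; nonempty  = λ i → let (v , eq) = surj i in v , ∈-tabulate⁺ (dec-true (col v ≟ i) eq)
  ; partition = λ v → col v , ∈-tabulate⁺ (δ-refl (col v)) , ∈-class
  ; odd       = λ i v v∈ → odd i v (∈-class v∈)
  }
  where
  class : Fin k → Subset n
  class i = tabulate (λ u → δ (col u) i)
  ∈-class : ∀ {v i} → v ∈ class i → col v ≡ i
  ∈-class {v} {i} v∈ = does-true (col v ≟ i) (∈-tabulate⁻ v∈)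
  odd : ∀ i v → col v ≡ i → Odd (degreeIn G (class i) v)
  odd i v refl = ⨁≡true⇒odd (N G v ∩ class i) (trans
    (sum-cong-≗ (λ u → trans (lookup-∩ (N G v) (class i) u)
      (cong (lookup (N G v) u ∧_) (lookup∘tabulate (λ u → δ (col u) i) u))))
    (isOdd v))

dropColour : ∀ {G : Graph n} {k} ((col , _) : OddColouring G (suc k)) i →
             (∀ v → col v ≢ i) → OddColouring G k
dropColour {G = G} (col , isOdd) i unused =
  (λ v → punchOut (unused v ∘ sym)) ,
  isOddColouring-cong G col (λ v → punchOut (unused v ∘ sym))
    (λ u v → does-⇔ (mk⇔ (punchOut-cong i) (punchOut-injective (unused u ∘ sym) (unused v ∘ sym)))
                    (col u ≟ col v) (punchOut (unused u ∘ sym) ≟ punchOut (unused v ∘ sym)))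
    isOdd

least : ∀ {P : ℕ → Set} → (∀ k → Dec (P k)) → ∀ {k} → P k → ∃ λ c → P c × (∀ d → P d → c ≤ d)
least {P} P? {k} = go (<-wellFounded k)
  where
  go : ∀ {k} → Acc _<_ k → P k → ∃ λ c → P c × (∀ d → P d → c ≤ d)
  go {k} (acc rs) p with any? (λ (i : Fin k) → P? (toℕ i))
  ... | yes (i , q) = go (rs (toℕ<n i)) q
  ... | no none = k , p , λ d q → ≮⇒≥ (λ d<k → none (fromℕ< d<k , subst P (sym (toℕ-fromℕ< d<k)) q))

minimalColouring⇒partition : ∀ {G : Graph n} {c} → OddColouring G c →
                             (∀ d → OddColouring G d → c ≤ d) → OddPartition G c
minimalColouring⇒partition {c = zero} C minimal = surjectiveColouring⇒partition C (λ ())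
minimalColouring⇒partition {G = G} {suc c} C minimal = surjectiveColouring⇒partition C surj
  where
  surj : ∀ i → ∃ λ v → proj₁ C v ≡ i
  surj i = decidable-stable (any? (λ v → proj₁ C v ≟ i))
    (λ unused → <-irrefl refl (minimal c (dropColour {G = G} C i (λ v eq → unused (v , eq)))))

oddChromaticNumber : ∀ {G : Graph n} {k} → OddColouring G k → ∃ (IsOddChromaticNumber G)
oddChromaticNumber {G = G} C with least (oddColouring? G) C
... | c , C′ , minimal = c , minimalColouring⇒partition C′ minimal , λ d → minimal d ∘ partition⇒colouring

oddChromaticNumber-≤ : ∀ {G : Graph n} {c k} → IsOddChromaticNumber G c → OddColouring G k → c ≤ k
oddChromaticNumber-≤ {G = G} (_ , minimal) C with least (oddColouring? G) C
... | c′ , C′ , minimal′ = ≤-trans (minimal c′ (minimalColouring⇒partition C′ minimal′)) (minimal′ _ C)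

-- Odd colourings from tree decompositions

-- One more than the width of `D`, as a natural number that can count colours.
maxBag : ∀ {G : Graph n} → TreeDecomposition G → ℕ
maxBag D = max 0 (map (λ t → ∣ TreeDecomposition.bag D t ∣) (allFin (TreeDecomposition.size D)))

-- Adjacent vertices share a bag, so if they have the same colour they lie in one class and, the
-- class being induced, are adjacent in `H`. Degrees in a colour class are therefore the odd degrees
-- of `H`.
induced⇒colouring : ∀ {G : Graph n} (H : OddSpanning G) → Induced H → (D : TreeDecomposition G) →
                    OddColouring G (maxBag D)
induced⇒colouring {n} {G} H induced D = col , λ v → trans (sum-cong-≗ (neighbours v)) (E-odd H v)
  where
  open TreeDecomposition D
  open ClassColouring H D {maxBag D} (λ t → lookupAll (xs≤max 0 _) (∈-map⁺ (λ t → ∣ bag t ∣) (∈-allFin t)))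
  col : Fin n → Fin (maxBag D)
  col = proj₁ classColouring
  resp : Respects col
  resp = proj₁ (proj₂ classColouring)
  sep : ∀ t → Separates col t
  sep = proj₂ (proj₂ classColouring)
  neighbours : ∀ v u → lookup (N G v) u ∧ δ (col u) (col v) ≡ E H v u
  neighbours v u = ≡true-ext to from
    where
    to : lookup (N G v) u ∧ δ (col u) (col v) ≡ true → E H v u ≡ true
    to eq with lookup (N G v) u in Nvu | col u ≟ col v
    ... | true | yes same = induced (sep t v∈ u∈ (sym same)) v—u
      where
      v—u : Adj G v u
      v—u = lookup⇒[]= u (N G v) Nvu
      t = proj₁ (coversEdges v u v—u)
      v∈ = proj₁ (proj₂ (coversEdges v u v—u))
      u∈ = proj₂ (proj₂ (coversEdges v u v—u))
    from : E H v u ≡ true → lookup (N G v) u ∧ δ (col u) (col v) ≡ true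
    from e = cong₂ _∧_ ([]=⇒lookup (E⇒adj H e)) (dec-true (col u ≟ col v) (sym (resp (e ◅ ε))))

abstract
  treeDecomposition⇒colouring : ∀ {G : Graph n} → AllComponentsEven G → (D : TreeDecomposition G) →
                                OddColouring G (maxBag D)
  treeDecomposition⇒colouring {G = G} even =
    let (H , induced) = inducedOddSpanning (oddSpanning G even) in induced⇒colouring H induced

-- Star-shaped tree decompositions

starGraph : ∀ n → Graph (suc n)
starGraph n = record { N = N⋆ ; symmetric = λ {u} {v} → sym⋆ u v ; loopless = loopless⋆ }
  where
  N⋆ : Fin (suc n) → Subset (suc n)
  N⋆ zero    = false ∷ ⊤
  N⋆ (suc _) = true ∷ ⊥
  sym⋆ : ∀ u v → v ∈ N⋆ u → u ∈ N⋆ v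
  sym⋆ zero    (suc v) _          = here
  sym⋆ (suc u) zero    _          = there ∈⊤
  sym⋆ (suc u) (suc v) (there v∈) = contradiction v∈ ∉⊥
  loopless⋆ : ∀ v → v ∉ N⋆ v
  loopless⋆ (suc v) (there v∈) = ∉⊥ v∈

starGraph-adj : ∀ {n} {u v : Fin (suc n)} → Adj (starGraph n) u v → u ≡ zero ⊎ v ≡ zero
starGraph-adj {u = zero}              _          = inj₁ refl
starGraph-adj {u = suc _} {v = zero}  _          = inj₂ refl
starGraph-adj {u = suc _} {v = suc _} (there v∈) = contradiction v∈ ∉⊥

starGraph-isTree : ∀ n → IsTree (starGraph n)
starGraph-isTree n = record { root = zero ; connected = λ s t → inwards s ◅◅ outwards t ; acyclic = acyclic }
  where
  inwards : ∀ s → Star (Adj (starGraph n)) s zero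
  inwards zero    = ε
  inwards (suc s) = here ◅ ε
  outwards : ∀ t → Star (Adj (starGraph n)) zero t
  outwards zero    = ε
  outwards (suc t) = there ∈⊤ ◅ ε
  -- Every edge of the star contains the centre, and the distinct `x` and `z` cannot both be it. A
  -- cycle would have two consecutive middle vertices, both equal to the centre.
  middle : ∀ {x y z : Fin (suc n)} → x ≢ z → Adj (starGraph n) x y → Adj (starGraph n) y z → y ≡ zero
  middle x≢z x—y y—z with starGraph-adj x—y | starGraph-adj y—z
  ... | inj₂ y≡0 | _        = y≡0
  ... | inj₁ _   | inj₁ y≡0 = y≡0
  ... | inj₁ x≡0 | inj₂ z≡0 = contradiction (trans x≡0 (sym z≡0)) x≢z
  acyclic : ¬ HasCycle (starGraph n)
  acyclic (x , _ ∷ [] , s≤s () , _)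
  acyclic (x , y ∷ z ∷ [] , _ , (x≢y ∷ x≢z ∷ []) ∷ (y≢z ∷ []) ∷ _ , x—y ∷ y—z ∷ z—x ∷ [-]) =
    y≢z (trans (middle x≢z x—y y—z) (sym (middle (x≢y ∘ sym) y—z z—x)))
  acyclic (x , y ∷ z ∷ z′ ∷ _ , _ , (x≢y ∷ x≢z ∷ _) ∷ (y≢z ∷ y≢z′ ∷ _) ∷ _ , x—y ∷ y—z ∷ z—z′ ∷ _) =
    y≢z (trans (middle x≢z x—y y—z) (sym (middle y≢z′ y—z z—z′)))

module VertexCover (G : Graph n) (C : Subset n) (cover : ∀ {u v} → Adj G u v → u ∈ C ⊎ v ∈ C) where

  -- For `v ∈ C` the leaf repeats the bag of the centre, so that leaves can be indexed by all
  -- vertices.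
  leaf : ∀ v → Dec (v ∈ C) → Subset n
  leaf v (yes _) = C
  leaf v (no _)  = ⁅ v ⁆ ∪ N G v

  starBag : Fin (suc n) → Subset n
  starBag zero    = C
  starBag (suc v) = leaf v (v ∈? C)

  v∈leaf : ∀ v (d : Dec (v ∈ C)) → v ∈ leaf v d
  v∈leaf v (yes v∈C) = v∈C
  v∈leaf v (no _)    = p⊆p∪q (N G v) (x∈⁅x⁆ v)

  N⊆leaf : ∀ {v u} → v ∉ C → (d : Dec (v ∈ C)) → u ∈ N G v → u ∈ leaf v d
  N⊆leaf v∉ (yes v∈)    u∈ = contradiction v∈ v∉
  N⊆leaf {v} v∉ (no _) u∈ = q⊆p∪q ⁅ v ⁆ (N G v) u∈

  -- All neighbours of a vertex `v` outside the cover lie in the cover, so `v` is the only element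
  -- of its bag outside `C`.
  leaf-private : ∀ {v x} → x ∉ C → (d : Dec (v ∈ C)) → x ∈ leaf v d → v ≡ x
  leaf-private x∉ (yes _) x∈ = contradiction x∈ x∉
  leaf-private {v} x∉ (no v∉) x∈ with x∈p∪q⁻ ⁅ v ⁆ (N G v) x∈
  ... | inj₁ x∈⁅v⁆ = sym (x∈⁅y⁆⇒x≡y v x∈⁅v⁆)
  ... | inj₂ v—x   = [ (λ v∈ → contradiction v∈ v∉) , (λ x∈ → contradiction x∈ x∉) ]′ (cover v—x)

  bag-private : ∀ {x} s → x ∉ C → x ∈ starBag s → s ≡ suc x
  bag-private zero    x∉ x∈ = contradiction x∈ x∉
  bag-private (suc v) x∉ x∈ = cong suc (leaf-private x∉ (v ∈? C) x∈)

  starEdges : ∀ u v → Adj G u v → ∃ λ t → u ∈ starBag t × v ∈ starBag t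
  starEdges u v u—v = go (u ∈? C) (v ∈? C)
    where
    go : Dec (u ∈ C) → Dec (v ∈ C) → ∃ λ t → u ∈ starBag t × v ∈ starBag t
    go (yes u∈) (yes v∈) = zero , u∈ , v∈
    go (no u∉)  _        = suc u , v∈leaf u (u ∈? C) , N⊆leaf u∉ (u ∈? C) u—v
    go (yes _)  (no v∉)  = suc v , N⊆leaf v∉ (v ∈? C) (symmetric G u—v) , v∈leaf v (v ∈? C)

  BagWalk : Fin n → Fin (suc n) → Fin (suc n) → Set
  BagWalk x = Star (λ a b → x ∈ starBag a × x ∈ starBag b × Adj (starGraph n) a b)

  inwards : ∀ {x} s → x ∈ C → x ∈ starBag s → BagWalk x s zero
  inwards zero    x∈C x∈s = ε
  inwards (suc v) x∈C x∈s = (x∈s , x∈C , here) ◅ ε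

  outwards : ∀ {x} t → x ∈ C → x ∈ starBag t → BagWalk x zero t
  outwards zero    x∈C x∈t = ε
  outwards (suc v) x∈C x∈t = (x∈C , x∈t , there ∈⊤) ◅ ε

  starConnected : ∀ x s t → x ∈ starBag s → x ∈ starBag t → BagWalk x s t
  starConnected x s t x∈s x∈t = go (x ∈? C)
    where
    go : Dec (x ∈ C) → BagWalk x s t
    go (yes x∈) = inwards s x∈ x∈s ◅◅ outwards t x∈ x∈t
    go (no x∉)  = subst (BagWalk x s) (trans (bag-private s x∉ x∈s) (sym (bag-private t x∉ x∈t))) ε

  decomposition : TreeDecomposition G
  decomposition = record
    { size           = suc n
    ; tree           = starGraph n
    ; isTree         = starGraph-isTree n
    ; bag            = starBag
    ; coversVertices = λ v → suc v , v∈leaf v (v ∈? C)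
    ; coversEdges    = starEdges
    ; nodesConnected = starConnected
    }

  decomposition-maxBag : ∀ {k} → ∣ C ∣ ≤ k → (∀ {v} → v ∉ C → ∣ N G v ∣ < k) → maxBag decomposition ≤ k
  decomposition-maxBag {k} C≤k deg<k = max≤v⁺ z≤n (All-map⁺ (universalAll bag≤k (allFin (suc n))))
    where
    leaf≤k : ∀ v d → ∣ leaf v d ∣ ≤ k
    leaf≤k v (yes _) = C≤k
    leaf≤k v (no v∉) = ≤-trans (∣p∪q∣≤∣p∣+∣q∣ ⁅ v ⁆ (N G v))
      (≤-trans (≤-reflexive (cong (_+ ∣ N G v ∣) (∣⁅x⁆∣≡1 v))) (deg<k v∉))
    bag≤k : ∀ t → ∣ starBag t ∣ ≤ k
    bag≤k zero    = C≤k
    bag≤k (suc v) = leaf≤k v (v ∈? C)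

-- The upper bound

pred-suc : ∀ a → (+ a ℤ.- + 1) ℤ.+ + 1 ≡ + a
pred-suc zero    = refl
pred-suc (suc a) = cong +_ (+-comm a 1)

upperBound : ∀ {n} (G : Graph n) → AllComponentsEven G →
  ∃ λ c → IsOddChromaticNumber G c × (∀ w → IsTreeWidth G w → + c ℤ.≤ w ℤ.+ + 1)
upperBound G even = proj₁ χ , proj₂ χ , λ { w ((D , refl) , _) →
    subst (+ proj₁ χ ℤ.≤_) (sym (pred-suc (maxBag D)))
      (+≤+ (oddChromaticNumber-≤ (proj₂ χ) (treeDecomposition⇒colouring even D))) }
  where
  χ : ∃ (IsOddChromaticNumber G)
  -- The trivial cover `⊤` gives some decomposition, hence some odd colouring; this only serves the
  -- existence of the odd chromatic number.
  χ = oddChromaticNumber (treeDecomposition⇒colouring even (VertexCover.decomposition G ⊤ (λ _ → inj₁ ∈⊤)))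

-- Graphs attaining the bound

-- Every decomposition `D` yields an odd colouring with `maxBag D` colours, so `lower` bounds the
-- bags of all decompositions as well as the colours. The star-shaped decomposition meets both
-- bounds.
coverBound-tight : ∀ {G : Graph n} {k} → AllComponentsEven G →
  (C : Subset n) → (∀ {u v} → Adj G u v → u ∈ C ⊎ v ∈ C) →
  ∣ C ∣ ≤ suc k → (∀ {v} → v ∉ C → ∣ N G v ∣ < suc k) →
  (∀ d → OddColouring G d → suc k ≤ d) →
  IsTreeWidth G (+ k) × IsOddChromaticNumber G (suc k)
coverBound-tight {G = G} {k} even C cover C≤ deg≤ lower =
  ((D , cong (λ a → + a ℤ.- + 1) maxBag-D) , width≥) ,
  (minimalColouring⇒partition colouring lower , λ d → lower d ∘ partition⇒colouring)
  where
  open VertexCover G C cover renaming (decomposition to D)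
  maxBag≥ : ∀ D → suc k ≤ maxBag D
  maxBag≥ D = lower (maxBag D) (treeDecomposition⇒colouring even D)
  maxBag-D : maxBag D ≡ suc k
  maxBag-D = ≤-antisym (decomposition-maxBag C≤ deg≤) (maxBag≥ D)
  colouring : OddColouring G (suc k)
  colouring = subst (OddColouring G) maxBag-D (treeDecomposition⇒colouring even D)
  width≥ : ∀ D → + k ℤ.≤ width D
  width≥ D = pred-≤ (maxBag≥ D)
    where
    pred-≤ : ∀ {a} → suc k ≤ a → + k ℤ.≤ + a ℤ.- + 1
    pred-≤ (s≤s k≤a) = +≤+ k≤a

connected⇒allComponentsEven : ∀ {G : Graph n} → Even n → (r : Fin n) → (∀ v → Star (Adj G) v r) →
                              AllComponentsEven G
connected⇒allComponentsEven {n} {G} even r to-r C (v , ∈C⇔) = subst Even (sym ∣C∣≡n) even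
  where
  ⊤⊆C : ⊤ ⊆ C
  ⊤⊆C {u} _ = Equivalence.from (∈C⇔ u) (to-r v ◅◅ reverse (symmetric G) (to-r u))
  ∣C∣≡n : ∣ C ∣ ≡ n
  ∣C∣≡n = ≤-antisym (∣p∣≤n C) (≤-trans (≤-reflexive (sym (∣⊤∣≡n n))) (p⊆q⇒∣p∣≤∣q∣ ⊤⊆C))

boolGraph : (adj : Fin n → Fin n → Bool) → (∀ u v → adj u v ≡ adj v u) → (∀ v → adj v v ≡ false) → Graph n
boolGraph adj adj-sym irrefl = record
  { N         = λ u → tabulate (adj u)
  ; symmetric = λ {u} {v} v∈ → ∈-tabulate⁺ (trans (adj-sym v u) (∈-tabulate⁻ v∈))
  ; loopless  = λ v v∈ → contradiction (trans (sym (∈-tabulate⁻ v∈)) (irrefl v)) λ ()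
  }

image : ∀ {k} → (Fin k → Fin n) → Subset n
image {k = zero}  f = ⊥
image {k = suc k} f = ⁅ f zero ⁆ ∪ image (f ∘ suc)

∈-image : ∀ {k} (f : Fin k → Fin n) i → f i ∈ image f
∈-image f zero    = p⊆p∪q (image (f ∘ suc)) (x∈⁅x⁆ (f zero))
∈-image f (suc i) = q⊆p∪q ⁅ f zero ⁆ (image (f ∘ suc)) (∈-image (f ∘ suc) i)

∣image∣≤ : ∀ {k} (f : Fin k → Fin n) → ∣ image f ∣ ≤ k
∣image∣≤ {n} {k = zero}  f = ≤-reflexive (∣⊥∣≡0 n)
∣image∣≤ {k = suc k} f = ≤-trans (∣p∪q∣≤∣p∣+∣q∣ ⁅ f zero ⁆ (image (f ∘ suc)))
  (+-mono-≤ (≤-reflexive (∣⁅x⁆∣≡1 (f zero))) (∣image∣≤ (f ∘ suc)))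

path₄ : Graph 4
path₄ = boolGraph adj adj-sym irrefl
  where
  adj : Fin 4 → Fin 4 → Bool
  adj 0F 1F = true
  adj 1F 0F = true
  adj 1F 2F = true
  adj 2F 1F = true
  adj 2F 3F = true
  adj 3F 2F = true
  adj _  _  = false
  adj-sym : ∀ u v → adj u v ≡ adj v u
  adj-sym = toWitness {a? = all? (λ u → all? (λ v → adj u v ≟ᵇ adj v u))} tt
  irrefl : ∀ v → adj v v ≡ false
  irrefl = toWitness {a? = all? (λ v → adj v v ≟ᵇ false)} tt

path₄-even : AllComponentsEven path₄
path₄-even = connected⇒allComponentsEven {G = path₄} (divides 2 refl) 1F
  (toWitness {a? = all? (λ v → connected? path₄ v 1F)} tt)

-- With a single colour, the inner vertex `1F` would have degree two in its class.
path₄-colours : ∀ d → OddColouring path₄ d → 2 ≤ d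
path₄-colours zero          (col , _)   = contradiction (col 0F) λ ()
path₄-colours (suc zero)    (col , odd) with col 0F | col 1F | col 2F | odd 1F
... | zero | zero | zero | ()
path₄-colours (suc (suc d)) _ = s≤s (s≤s z≤n)

path₄-tight : IsTreeWidth path₄ (+ 1) × IsOddChromaticNumber path₄ 2
path₄-tight = coverBound-tight {G = path₄} path₄-even C
  (λ {u} {v} → toWitness {a? = all? (λ u → all? (λ v → adj? path₄ u v →-dec (u ∈? C ⊎-dec v ∈? C)))} tt u v)
  ≤-refl
  (λ {v} → toWitness {a? = all? (λ v → ¬? (v ∈? C) →-dec (∣ N path₄ v ∣ <ⁿ? 2))} tt v)
  path₄-colours
  where
  C : Subset 4
  -- The two inner vertices cover all edges, and the end vertices have degree one.
  C = false ∷ true ∷ true ∷ false ∷ []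

-- Branch vertices i < m, and for every ordered pair (i , j), including i = j, a vertex
-- adjacent to exactly i and j. The diagonal pairs make the order m (m + 1) even.
module Subdivided (m′ : ℕ) where

  private
    m : ℕ
    m = suc m′

    -- A second coordinate `zero` marks a branch vertex, and `(a , suc b)` is the middle vertex for
    -- the pair `(a , b)`.
    V : Set
    V = Fin m × Fin (suc m)

    adjV : V → V → Bool
    adjV (i , zero)  (a , suc b) = δ i a ∨ δ i b
    adjV (a , suc b) (i , zero)  = δ i a ∨ δ i b
    adjV _           _           = false

    adjV-sym : ∀ x y → adjV x y ≡ adjV y x
    adjV-sym (_ , zero)  (_ , zero)  = refl
    adjV-sym (_ , zero)  (_ , suc _) = refl
    adjV-sym (_ , suc _) (_ , zero)  = refl
    adjV-sym (_ , suc _) (_ , suc _) = refl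

    adjV-irrefl : ∀ x → adjV x x ≡ false
    adjV-irrefl (_ , zero)  = refl
    adjV-irrefl (_ , suc _) = refl

    code : V → Fin (m * suc m)
    code (i , j) = combine i j

    decode : Fin (m * suc m) → V
    decode = remQuot (suc m)

    decode-code : ∀ x → decode (code x) ≡ x
    decode-code (i , j) = remQuot-combine i j

  G : Graph (m * suc m)
  G = boolGraph (λ u v → adjV (decode u) (decode v)) (λ u v → adjV-sym (decode u) (decode v))
                (λ v → adjV-irrefl (decode v))

  branch : Fin m → Fin (m * suc m)
  branch i = code (i , zero)

  mid : Fin m → Fin m → Fin (m * suc m)
  mid a b = code (a , suc b)

  data View : Fin (m * suc m) → Set where
    isBranch : ∀ i → View (branch i)
    isMid    : ∀ a b → View (mid a b)

  view : ∀ x → View x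
  view x = subst View (combine-remQuot {m} (suc m) x) (viewCode (decode x))
    where
    viewCode : ∀ y → View (code y)
    viewCode (i , zero)  = isBranch i
    viewCode (a , suc b) = isMid a b

  adj⇒ : ∀ x y → Adj G (code x) (code y) → adjV x y ≡ true
  adj⇒ x y e = trans (sym (cong₂ adjV (decode-code x) (decode-code y)))
    (∈-tabulate⁻ {f = λ v → adjV (decode (code x)) (decode v)} e)

  adj⇐ : ∀ x y → adjV x y ≡ true → Adj G (code x) (code y)
  adj⇐ x y e = ∈-tabulate⁺ {f = λ v → adjV (decode (code x)) (decode v)}
    (trans (cong₂ adjV (decode-code x) (decode-code y)) e)

  mid—branchˡ : ∀ a b → Adj G (mid a b) (branch a)
  mid—branchˡ a b = adj⇐ (a , suc b) (a , zero) (cong (_∨ δ a b) (δ-refl a))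

  mid—branchʳ : ∀ a b → Adj G (mid a b) (branch b)
  mid—branchʳ a b = adj⇐ (a , suc b) (b , zero) (trans (cong (δ b a ∨_) (δ-refl b)) (∨-zeroʳ (δ b a)))

  mid-neighbour : ∀ a b u → Adj G (mid a b) u → u ≡ branch a ⊎ u ≡ branch b
  mid-neighbour a b u e with view u
  ... | isMid c d  = contradiction (adj⇒ (a , suc b) (c , suc d) e) λ ()
  ... | isBranch i = ends (i ≟ a) (i ≟ b) (adj⇒ (a , suc b) (i , zero) e)
    where
    ends : (d : Dec (i ≡ a)) (d′ : Dec (i ≡ b)) → does d ∨ does d′ ≡ true →
           branch i ≡ branch a ⊎ branch i ≡ branch b
    ends (yes refl) _          _ = inj₁ refl
    ends (no _)     (yes refl) _ = inj₂ refl

  branch-cover : ∀ {u v} → Adj G u v → u ∈ image branch ⊎ v ∈ image branch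
  branch-cover {u} {v} e with view u
  ... | isBranch i = inj₁ (∈-image branch i)
  ... | isMid a b with mid-neighbour a b v e
  ...   | inj₁ eq = inj₂ (subst (_∈ image branch) (sym eq) (∈-image branch a))
  ...   | inj₂ eq = inj₂ (subst (_∈ image branch) (sym eq) (∈-image branch b))

  mid-degree : ∀ {v} → v ∉ image branch → ∣ N G v ∣ ≤ 2
  mid-degree {v} v∉ with view v
  ... | isBranch i = contradiction (∈-image branch i) v∉
  ... | isMid a b  = ≤-trans (p⊆q⇒∣p∣≤∣q∣ N⊆) (≤-trans (∣p∪q∣≤∣p∣+∣q∣ ⁅ branch a ⁆ ⁅ branch b ⁆)
                       (≤-reflexive (cong₂ _+_ (∣⁅x⁆∣≡1 (branch a)) (∣⁅x⁆∣≡1 (branch b)))))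
    where
    N⊆ : N G (mid a b) ⊆ ⁅ branch a ⁆ ∪ ⁅ branch b ⁆
    N⊆ {u} u∈ with mid-neighbour a b u u∈
    ... | inj₁ refl = p⊆p∪q ⁅ branch b ⁆ (x∈⁅x⁆ (branch a))
    ... | inj₂ refl = q⊆p∪q ⁅ branch a ⁆ ⁅ branch b ⁆ (x∈⁅x⁆ (branch b))

  from-branch : ∀ i → Star (Adj G) (branch i) (branch zero)
  from-branch i = symmetric G {mid i zero} (mid—branchˡ i zero) ◅ mid—branchʳ i zero ◅ ε

  to-root : ∀ v → Star (Adj G) v (branch zero)
  to-root v with view v
  ... | isBranch i = from-branch i
  ... | isMid a b  = mid—branchˡ a b ◅ from-branch a

  allComponentsEven : AllComponentsEven G
  allComponentsEven = connected⇒allComponentsEven {G = G} even (branch zero) to-root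
    where
    even : Even (m * suc m)
    even with 2 ∣? m
    ... | yes 2∣m = ∣m⇒∣m*n (suc m) 2∣m
    ... | no 2∤m  = ∣n⇒∣m*n m (even-suc m 2∤m)

  -- Two branch vertices i ≠ j of one colour would give mid i j degree 0 or 2 in its class.
  branch-distinct : ∀ {d} ((col , _) : OddColouring G d) i j → col (branch i) ≡ col (branch j) → i ≡ j
  branch-distinct (col , odd) i j same with i ≟ j
  ... | yes i≡j = i≡j
  ... | no i≢j  = contradiction (trans (sym (odd (mid i j))) (trans (sum-cong-≗ pointwise) even)) λ ()
    where
    -- Whether the middle vertex has the common colour of the two branch vertices. Both neighbours
    -- then contribute the same `c`, and the sum vanishes modulo 2.
    c : Bool
    c = δ (col (branch i)) (col (mid i j))

    bi≢bj : branch i ≢ branch j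
    bi≢bj eq = i≢j (combine-injectiveˡ i zero j zero eq)

    even : ⨁ (λ u → (c ∧ δ u (branch i)) xor (c ∧ δ u (branch j))) ≡ false
    even = trans (∑-distrib-+ (λ u → c ∧ δ u (branch i)) (λ u → c ∧ δ u (branch j)))
             (trans (cong₂ _xor_ (⨁-∧δ c (branch i)) (⨁-∧δ c (branch j))) (xor-same c))

    pointwise : ∀ u → lookup (N G (mid i j)) u ∧ δ (col u) (col (mid i j))
                      ≡ (c ∧ δ u (branch i)) xor (c ∧ δ u (branch j))
    pointwise u = go (u ≟ branch i) (u ≟ branch j)
      where
      go : Dec (u ≡ branch i) → Dec (u ≡ branch j) →
           lookup (N G (mid i j)) u ∧ δ (col u) (col (mid i j))
           ≡ (c ∧ δ u (branch i)) xor (c ∧ δ u (branch j))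
      go (yes refl) _ = trans (cong (_∧ c) ([]=⇒lookup (mid—branchˡ i j)))
        (sym (trans (cong₂ (λ a b → (c ∧ a) xor (c ∧ b)) (δ-refl (branch i)) (dec-false (branch i ≟ branch j) bi≢bj))
             (trans (cong₂ _xor_ (∧-identityʳ c) (∧-zeroʳ c)) (xor-identityʳ c))))
      go (no _) (yes refl) = trans (cong₂ _∧_ ([]=⇒lookup (mid—branchʳ i j))
                                              (cong (λ a → δ a (col (mid i j))) (sym same)))
        (sym (trans (cong₂ (λ a b → (c ∧ a) xor (c ∧ b)) (dec-false (branch j ≟ branch i) (bi≢bj ∘ sym)) (δ-refl (branch j)))
             (cong₂ _xor_ (∧-zeroʳ c) (∧-identityʳ c))))
      go (no u≢i) (no u≢j) = trans (cong (_∧ δ (col u) (col (mid i j))) (¬-not not-adj))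
        (sym (trans (cong₂ (λ a b → (c ∧ a) xor (c ∧ b)) (dec-false (u ≟ branch i) u≢i) (dec-false (u ≟ branch j) u≢j))
             (cong₂ _xor_ (∧-zeroʳ c) (∧-zeroʳ c))))
        where
        not-adj : lookup (N G (mid i j)) u ≢ true
        not-adj eq = [ u≢i , u≢j ]′ (mid-neighbour i j u (lookup⇒[]= u _ eq))

  tight : 2 ≤ m′ → IsTreeWidth G (+ m′) × IsOddChromaticNumber G m
  tight 2≤m′ = coverBound-tight {G = G} allComponentsEven (image branch) branch-cover (∣image∣≤ branch)
    -- A middle vertex and its neighbours form a bag of up to three vertices; this fits into size
    -- `m` because `2 ≤ m′`.
    (λ v∉ → s≤s (≤-trans (mid-degree v∉) 2≤m′))
    (λ d C → injective⇒≤ (λ {i} {j} → branch-distinct C i j))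

lowerBound : ∀ k → 1 ≤ k →
  ∃ λ n → Σ (Graph n) λ G → AllComponentsEven G × IsTreeWidth G (+ k) × IsOddChromaticNumber G (suc k)
lowerBound (suc zero)        _ = 4 , path₄ , path₄-even , path₄-tight
lowerBound k@(suc (suc _))   _ = _ , G , allComponentsEven , tight (s≤s (s≤s z≤n))
  where open Subdivided k

theorem7 : (∀ {n} (G : Graph n) → AllComponentsEven G →
    ∃ λ c → IsOddChromaticNumber G c × (∀ w → IsTreeWidth G w → + c ℤ.≤ w ℤ.+ + 1))
    ×
    (∀ k → 1 ≤ k →
    ∃ λ n → Σ (Graph n) λ G → AllComponentsEven G × IsTreeWidth G (+ k) × IsOddChromaticNumber G (k + 1))
theorem7 = upperBound , λ k 1≤k → let (n , G , even , tw , χ) = lowerBound k 1≤k in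
  n , G , even , tw , subst (IsOddChromaticNumber G) (+-comm 1 k) χ
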